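{- The logics $\mathsf L(\mathfrak G_2)$ and $\mathsf L(\mathfrak G_2)\cap\mathsf L(\mathfrak C_5)$ have finitary unification, but neither of them has projective approximation.
   Context: A frame is a finite poset with a least element; $\mathsf L(\mathfrak F)$ is the set of intuitionistic formulas valid in all Kripke models over $\mathfrak F$. $\mathfrak G_2$: elements $r,a,b,c,d$ with $r<a$, $r<b$, $b<c$, $b<d$ (and transitivity), $a,c,d$ maximal, no other relations. $\mathfrak C_5$: elements $r,a,b,c,t,d$ with $r<a$, $r<b$, $a<c$, $a<t$, $b<t$, $b<d$ (and transitivity), $c,t,d$ maximal, no other relations. Unification in $\mathsf L$ is finitary if it is not unitary and every $\mathsf L$-unifiable formula has a finite complete set of unifiers (a set $\Sigma$ such that every unifier $\mu$ has some $\varepsilon\in\Sigma$ with $\alpha\circ\varepsilon=_{\mathsf L}\mu$ for some substitution $\alpha$). An $\mathsf L$-unifier $\varepsilon$ of $A$ is projective if $A\vdash_{\mathsf L}\varepsilon(x)\leftrightarrow x$ for all variables $x$; $\mathsf L$ has projective approximation if for every $A$ there is a finite set $\Pi(A)$ of formulas having projective unifiers, each $B\in\Pi(A)$ with $\mathrm{Var}(B)\subseteq\mathrm{Var}(A)$ and $B\vdash_{\mathsf L}A$, such that each $\mathsf L$-unifier of $A$ unifies some $B\in\Pi(A)$. -}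

module Defs where

open import Data.Nat using (ℕ)
open import Data.Bool using (Bool; true; false; T)
open import Data.List using (List; [])
open import Data.List.Membership.Propositional using (_∈_)
open import Data.List.Relation.Unary.All using (All)
open import Data.List.Relation.Unary.Any using (Any)
open import Data.Product using (Σ; _×_; ∃)
open import Data.Sum using (_⊎_)
open import Data.Empty using (⊥)
open import Relation.Binary.PropositionalEquality using (_≡_)
open import Relation.Nullary using (¬_)

infixr 6 _∧_
infixr 5 _∨_
infixr 4 _⇒_

data Fm : Set where
  var : ℕ → Fm
  ⊥̇   : Fm
  _∧_ : Fm → Fm → Fm
  _∨_ : Fm → Fm → Fm
  _⇒_ : Fm → Fm → Fm

_⇔_ : Fm → Fm → Fm
A ⇔ B = (A ⇒ B) ∧ (B ⇒ A)

data Occ (x : ℕ) : Fm → Set where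
  here  : Occ x (var x)
  ∧l : ∀ {A B} → Occ x A → Occ x (A ∧ B)
  ∧r : ∀ {A B} → Occ x B → Occ x (A ∧ B)
  ∨l : ∀ {A B} → Occ x A → Occ x (A ∨ B)
  ∨r : ∀ {A B} → Occ x B → Occ x (A ∨ B)
  ⇒l : ∀ {A B} → Occ x A → Occ x (A ⇒ B)
  ⇒r : ∀ {A B} → Occ x B → Occ x (A ⇒ B)

Subst : Set
Subst = ℕ → Fm

sub : Subst → Fm → Fm
sub σ (var x) = σ x
sub σ ⊥̇ = ⊥̇
sub σ (A ∧ B) = sub σ A ∧ sub σ B
sub σ (A ∨ B) = sub σ A ∨ sub σ B
sub σ (A ⇒ B) = sub σ A ⇒ sub σ B

_∘ˢ_ : Subst → Subst → Subst
(α ∘ˢ ε) x = sub α (ε x)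

record Frame : Set₁ where
  field
    W   : Set
    _≤_ : W → W → Set

module _ (F : Frame) where
  open Frame F

  Valuation : Set
  Valuation = ℕ → W → Bool

  Monotone : Valuation → Set
  Monotone V = ∀ x {w w'} → w ≤ w' → T (V x w) → T (V x w')

  Forces : Valuation → W → Fm → Set
  Forces V w (var x) = T (V x w)
  Forces V w ⊥̇ = ⊥
  Forces V w (A ∧ B) = Forces V w A × Forces V w B
  Forces V w (A ∨ B) = Forces V w A ⊎ Forces V w B
  Forces V w (A ⇒ B) = ∀ w' → w ≤ w' → Forces V w' A → Forces V w' B

  LogicOf : Fm → Set
  LogicOf A = ∀ (V : Valuation) → Monotone V → ∀ w → Forces V w A

data G2 : Set where
  r a b c d : G2

leqG2 : G2 → G2 → Bool
leqG2 r _ = true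
leqG2 a a = true
leqG2 b b = true
leqG2 b c = true
leqG2 b d = true
leqG2 c c = true
leqG2 d d = true
leqG2 _ _ = false

𝔊₂ : Frame
𝔊₂ = record { W = G2 ; _≤_ = λ u v → T (leqG2 u v) }

data C5 : Set where
  r a b c t d : C5

leqC5 : C5 → C5 → Bool
leqC5 r _ = true
leqC5 a a = true
leqC5 a c = true
leqC5 a t = true
leqC5 b b = true
leqC5 b t = true
leqC5 b d = true
leqC5 c c = true
leqC5 t t = true
leqC5 d d = true
leqC5 _ _ = false

ℭ₅ : Frame
ℭ₅ = record { W = C5 ; _≤_ = λ u v → T (leqC5 u v) }

Logic : Set₁
Logic = Fm → Set

_∩L_ : Logic → Logic → Logic
(L₁ ∩L L₂) A = L₁ A × L₂ A

module _ (L : Logic) where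

  -- A ⊢_L B  (deduction theorem: A ⊢_L B iff A → B ∈ L)
  _⊢_ : Fm → Fm → Set
  A ⊢ B = L (A ⇒ B)

  _≈ˢ_ : Subst → Subst → Set
  ε ≈ˢ μ = ∀ x → L (ε x ⇔ μ x)

  Unifier : Fm → Subst → Set
  Unifier A σ = L (sub σ A)

  Unifiable : Fm → Set
  Unifiable A = ∃ λ σ → Unifier A σ

  Complete : Fm → List Subst → Set
  Complete A Σs = All (Unifier A) Σs
                × (∀ μ → Unifier A μ →
                     Any (λ ε → ∃ λ α → (α ∘ˢ ε) ≈ˢ μ) Σs)

  Unitary : Set
  Unitary = ∀ A → Unifiable A → ∃ λ ε → Complete A (ε Data.List.∷ [])

  Finitary : Set
  Finitary = ¬ Unitary × (∀ A → Unifiable A → ∃ λ Σs → Complete A Σs)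

  Projective : Fm → Subst → Set
  Projective A ε = Unifier A ε × (∀ x → A ⊢ (ε x ⇔ var x))

  HasProjectiveUnifier : Fm → Set
  HasProjectiveUnifier A = ∃ λ ε → Projective A ε

  ProjectiveApproximation : Set
  ProjectiveApproximation =
    ∀ A → ∃ λ (Π : List Fm) →
        All (λ B → HasProjectiveUnifier B
                 × (∀ x → Occ x B → Occ x A)
                 × B ⊢ A) Π
      × (∀ μ → Unifier A μ → Any (λ B → Unifier B μ) Π)

{-# OPTIONS --safe #-}
-- A unifier μ : n → k variables acts as a map f from Kripke models over k variables to models over n
-- variables.  Finitarity amounts to factoring μ through an ε in a number m of variables that depends on n
-- only, ε still unifying whatever μ unifies.  Colour the models over k variables by the n formulas μ x, by
-- "equivalent to a fork" (depth at most 2), and, at maximal points, by the set of points f(φ) for φ a fork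
-- below; this is a substitution α with m variables, acting as h.  A point of a model over m variables in the
-- image of h is lifted through h; the others are lifted by amalgamating, below the same root, lifts of their
-- successors, which is possible since the colours record which forks meet in a given maximal point.  The
-- resulting `lift` makes f ∘ lift a p-morphism up to equivalence, hence definable by an ε with α ∘ ε = μ.
--
-- Projective approximation fails for ¬¬x ∨ (¬¬x → x): it has a unifier under which a point with ¬¬x but not x
-- has depth 3, so it never lies with a ¬x point above a common root.  If the unifier unifies B, then B holds at
-- a point with ¬¬x but not x and at a ¬x point; a projective unifier of B fixes both, hence would have to map a
-- common root of the two to a model of the formula, and there is none.
module Submission where

open import Defs
open import Data.Bool using (Bool; true; false; T) renaming (_∨_ to _||_; _∧_ to _&&_)
open import Data.Bool.Properties using (T?; T-∨; T-∧; ∧-comm) renaming (_≟_ to _≟ᵇ_)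
open import Data.Empty using (⊥; ⊥-elim)
open import Data.List using (List; []; _∷_; _++_; map; filter; length; upTo; cartesianProductWith)
open import Data.List.Membership.Propositional using (_∈_; lose; find)
open import Data.List.Membership.Propositional.Properties
  using (∈-cartesianProductWith⁺; ∈-cartesianProductWith⁻; ∈-map⁺; ∈-map⁻; ∈-++⁺ˡ; ∈-++⁺ʳ; ∈-upTo⁺;
         ∈-upTo⁻; ∈-filter⁺; ∈-filter⁻)
open import Data.List.Properties using (filter-notAll; ≡-dec; ∷-injectiveˡ; ∷-injectiveʳ)
open import Data.List.Relation.Unary.All as All using (All; []; _∷_; all?)
open import Data.List.Relation.Unary.All.Properties
  using (¬All⇒Any¬)
  renaming (++⁺ to All-++⁺; map⁺ to All-map⁺)
open import Data.List.Relation.Unary.Any as Any using (Any; any?; here; there)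
open import Data.Nat
  using (ℕ; zero; suc; _<_; _+_; _∸_; _<?_; _≟_; _≡ᵇ_; _⊔_; s≤s; z≤n)
  renaming (_≤_ to _≤ⁿ_)
open import Data.Nat.Properties
  using (≡ᵇ⇒≡; ≡⇒≡ᵇ; m≤m⊔n; m≤n⊔m; <-≤-trans; n<1+n; ≤-pred; m<1+n⇒m<n∨m≡n; <⇒≱; m+n∸m≡n; m≤m+n;
         +-monoʳ-<; <-irrefl; m+n≮m; +-suc; <-irrelevant; ≮⇒≥; <⇒≤; m<n⇒m<1+n)
  renaming (≤-refl to ≤ⁿ-refl)
open import Data.Product using (Σ; _×_; ∃; _,_; proj₁; proj₂)
open import Data.Sum as Sum using (_⊎_; inj₁; inj₂; [_,_]′)
open import Data.Unit using (⊤; tt)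
open import Function using (_∘_; id; Equivalence)
open import Relation.Binary.PropositionalEquality using (_≡_; refl; sym; trans; cong; subst)
open import Relation.Nullary using (¬_; Dec; yes; no; ¬?; contradiction)
open import Relation.Nullary.Decidable
  using (map′; _×-dec_; _⊎-dec_; _→-dec_; decidable-stable; isYes; toWitness; fromWitness)
open import Relation.Unary using (Decidable)

-- Formulas in boundedly many variables, and canonical choice from lists.

infix 1 _iff_
_iff_ : Set → Set → Set
P iff Q = (P → Q) × (Q → P)

Below : ℕ → Fm → Set
Below k (var x) = x < k
Below k ⊥̇       = ⊤
Below k (A ∧ B) = Below k A × Below k B
Below k (A ∨ B) = Below k A × Below k B
Below k (A ⇒ B) = Below k A × Below k B

Below-mono : ∀ {k l} → k ≤ⁿ l → ∀ A → Below k A → Below l A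
Below-mono k≤l (var x) x<k       = <-≤-trans x<k k≤l
Below-mono k≤l ⊥̇       _         = tt
Below-mono k≤l (A ∧ B) (bA , bB) = Below-mono k≤l A bA , Below-mono k≤l B bB
Below-mono k≤l (A ∨ B) (bA , bB) = Below-mono k≤l A bA , Below-mono k≤l B bB
Below-mono k≤l (A ⇒ B) (bA , bB) = Below-mono k≤l A bA , Below-mono k≤l B bB

bound : Fm → ℕ
bound (var x) = suc x
bound ⊥̇       = 0
bound (A ∧ B) = bound A ⊔ bound B
bound (A ∨ B) = bound A ⊔ bound B
bound (A ⇒ B) = bound A ⊔ bound B

below-bound : ∀ A → Below (bound A) A
below-bound₂ : ∀ A B → Below (bound A ⊔ bound B) A × Below (bound A ⊔ bound B) B
below-bound (var x) = n<1+n x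
below-bound ⊥̇       = tt
below-bound (A ∧ B) = below-bound₂ A B
below-bound (A ∨ B) = below-bound₂ A B
below-bound (A ⇒ B) = below-bound₂ A B
below-bound₂ A B = Below-mono (m≤m⊔n _ _) A (below-bound A)
                 , Below-mono (m≤n⊔m (bound A) _) B (below-bound B)

sub-below : ∀ {k l} (σ : Subst) → (∀ x → x < k → Below l (σ x)) →
            ∀ A → Below k A → Below l (sub σ A)
sub-below σ bσ (var x) x<k       = bσ x x<k
sub-below σ bσ ⊥̇       _         = tt
sub-below σ bσ (A ∧ B) (bA , bB) = sub-below σ bσ A bA , sub-below σ bσ B bB
sub-below σ bσ (A ∨ B) (bA , bB) = sub-below σ bσ A bA , sub-below σ bσ B bB
sub-below σ bσ (A ⇒ B) (bA , bB) = sub-below σ bσ A bA , sub-below σ bσ B bB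

pick : ∀ {A : Set} {P : A → Set} → Decidable P → A → List A → A
pick P? z []       = z
pick P? z (x ∷ xs) with P? x
... | yes _ = x
... | no  _ = pick P? z xs

pick-any : ∀ {A : Set} {P : A → Set} (P? : Decidable P) {z} xs → Any P xs → P (pick P? z xs)
pick-any P? (x ∷ xs) any with P? x
pick-any P? (x ∷ xs) any         | yes px = px
pick-any P? (x ∷ xs) (here px)   | no ¬px = contradiction px ¬px
pick-any P? (x ∷ xs) (there any) | no ¬px = pick-any P? xs any

pick-none : ∀ {A : Set} {P : A → Set} (P? : Decidable P) {z} xs → ¬ Any P xs → pick P? z xs ≡ z
pick-none P? []       none = refl
pick-none P? (x ∷ xs) none with P? x
... | yes px = contradiction (here px) none
... | no  _  = pick-none P? xs (none ∘ there)

-- The first hit depends only on the extension of the predicate. Choosing in this way gives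
-- equivalent points propositionally equal representatives and lifts, so that `lift` is well defined
-- on equivalence classes.
pick-cong : ∀ {A : Set} {P Q : A → Set} (P? : Decidable P) (Q? : Decidable Q) →
            (∀ x → P x iff Q x) → ∀ {y z} xs → y ≡ z → pick P? y xs ≡ pick Q? z xs
pick-cong P? Q? P⇔Q []       y≡z = y≡z
pick-cong P? Q? P⇔Q (x ∷ xs) y≡z with P? x | Q? x
... | yes _  | yes _  = refl
... | no  _  | no  _  = pick-cong P? Q? P⇔Q xs y≡z
... | yes px | no ¬qx = contradiction (proj₁ (P⇔Q x) px) ¬qx
... | no ¬px | yes qx = contradiction (proj₂ (P⇔Q x) qx) ¬px

-- Kripke models over a finite frame: substitution, bisimulation, enumeration.

record FiniteFrame : Set₁ where
  field
    frame : Frame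
  open Frame frame public
  field
    _≤?_     : ∀ u v → Dec (u ≤ v)
    ≤-refl   : ∀ {u} → u ≤ u
    ≤-trans  : ∀ {u v w} → u ≤ v → v ≤ w → u ≤ w
    worlds   : List W
    ∈-worlds : ∀ w → w ∈ worlds

module Kripke (FF : FiniteFrame) where
  open FiniteFrame FF

  record Model : Set where
    constructor model
    field
      val  : Valuation frame
      mono : Monotone frame val
  open Model public

  Point : Set
  Point = Model × W

  infix 3 _⊩_ _⊩?_

  _⊩_ : Point → Fm → Set
  (M , w) ⊩ A = Forces frame (val M) w A

  everywhere? : ∀ {P : W → Set} → Decidable P → Dec (∀ w → P w)
  everywhere? P? = map′ (λ ps w → All.lookup ps (∈-worlds w)) (λ f → All.tabulate (λ {w} _ → f w))
                        (all? P? worlds)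

  above? : ∀ w {P : W → Set} → Decidable P → Dec (∀ v → w ≤ v → P v)
  above? w P? = everywhere? (λ v → (w ≤? v) →-dec P? v)

  somewhere? : ∀ w {P : W → Set} → Decidable P → Dec (∃ λ v → w ≤ v × P v)
  somewhere? w P? = map′ (λ any → Any.satisfied any) (λ (v , pv) → lose (∈-worlds v) pv)
                         (any? (λ v → (w ≤? v) ×-dec P? v) worlds)

  _⊩?_ : ∀ p A → Dec (p ⊩ A)
  (M , w) ⊩? var x   = T? (val M x w)
  p       ⊩? ⊥̇       = no id
  p       ⊩? (A ∧ B) = (p ⊩? A) ×-dec (p ⊩? B)
  p       ⊩? (A ∨ B) = (p ⊩? A) ⊎-dec (p ⊩? B)
  (M , w) ⊩? (A ⇒ B) = above? w (λ v → ((M , v) ⊩? A) →-dec ((M , v) ⊩? B))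

  persist : ∀ M {w v} → w ≤ v → ∀ A → (M , w) ⊩ A → (M , v) ⊩ A
  persist M w≤v (var x) w⊩        = mono M x w≤v w⊩
  persist M w≤v (A ∧ B) (⊩A , ⊩B) = persist M w≤v A ⊩A , persist M w≤v B ⊩B
  persist M w≤v (A ∨ B) ⊩A∨B      = Sum.map (persist M w≤v A) (persist M w≤v B) ⊩A∨B
  persist M w≤v (A ⇒ B) ⊩A⇒B      = λ u v≤u → ⊩A⇒B u (≤-trans w≤v v≤u)

  ⊮⇒-counterexample : ∀ M w A B → ¬ ((M , w) ⊩ (A ⇒ B)) →
                      ∃ λ v → w ≤ v × (M , v) ⊩ A × ¬ ((M , v) ⊩ B)
  ⊮⇒-counterexample M w A B ⊮
    with somewhere? w (λ v → ((M , v) ⊩? A) ×-dec ¬? ((M , v) ⊩? B))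
  ... | yes ex  = ex
  ... | no none = ⊥-elim (⊮ λ v w≤v ⊩A →
                    decidable-stable ((M , v) ⊩? B) λ ⊮B → none (v , w≤v , ⊩A , ⊮B))

  abstract
    -- The dual action of a substitution: `σ` unifies `A` exactly when every model in the image of
    -- `substModel σ` validates `A`.
    substModel : Subst → Model → Model
    substModel σ M = model (λ x w → isYes ((M , w) ⊩? σ x))
                           (λ x w≤v t → fromWitness (persist M w≤v (σ x) (toWitness t)))

    ⊩-sub : ∀ σ M w A → ((M , w) ⊩ sub σ A) iff ((substModel σ M , w) ⊩ A)
    ⊩-sub σ M w (var x) = fromWitness , toWitness
    ⊩-sub σ M w ⊥̇       = id , id
    ⊩-sub σ M w (A ∧ B) =
      (λ (⊩A , ⊩B) → proj₁ (⊩-sub σ M w A) ⊩A , proj₁ (⊩-sub σ M w B) ⊩B) ,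
      (λ (⊩A , ⊩B) → proj₂ (⊩-sub σ M w A) ⊩A , proj₂ (⊩-sub σ M w B) ⊩B)
    ⊩-sub σ M w (A ∨ B) =
      Sum.map (proj₁ (⊩-sub σ M w A)) (proj₁ (⊩-sub σ M w B)) ,
      Sum.map (proj₂ (⊩-sub σ M w A)) (proj₂ (⊩-sub σ M w B))
    ⊩-sub σ M w (A ⇒ B) =
      (λ ⊩A⇒B v w≤v ⊩A → proj₁ (⊩-sub σ M v B) (⊩A⇒B v w≤v (proj₂ (⊩-sub σ M v A) ⊩A))) ,
      (λ ⊩A⇒B v w≤v ⊩A → proj₂ (⊩-sub σ M v B) (⊩A⇒B v w≤v (proj₁ (⊩-sub σ M v A) ⊩A)))

  infix 4 _⊑[_]_ _~[_]_

  record _⊑[_]_ (p : Point) (k : ℕ) (q : Point) : Set where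
    constructor incl
    field transfer : ∀ A → Below k A → p ⊩ A → q ⊩ A
  open _⊑[_]_ public

  record _~[_]_ (p : Point) (k : ℕ) (q : Point) : Set where
    constructor equiv
    field agree : ∀ A → Below k A → (p ⊩ A) iff (q ⊩ A)
  open _~[_]_ public

  module _ {k : ℕ} where
    ~-refl : ∀ {p} → p ~[ k ] p
    ~-refl = equiv λ A bA → id , id

    ~-sym : ∀ {p q} → p ~[ k ] q → q ~[ k ] p
    ~-sym p~q = equiv λ A bA → proj₂ (agree p~q A bA) , proj₁ (agree p~q A bA)

    ~-trans : ∀ {p q s} → p ~[ k ] q → q ~[ k ] s → p ~[ k ] s
    ~-trans p~q q~s = equiv λ A bA → proj₁ (agree q~s A bA) ∘ proj₁ (agree p~q A bA)
                                   , proj₂ (agree p~q A bA) ∘ proj₂ (agree q~s A bA)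

    ~⇒⊑ : ∀ {p q} → p ~[ k ] q → p ⊑[ k ] q
    ~⇒⊑ p~q = incl λ A bA → proj₁ (agree p~q A bA)

    ~⇒⊒ : ∀ {p q} → p ~[ k ] q → q ⊑[ k ] p
    ~⇒⊒ p~q = ~⇒⊑ (~-sym p~q)

    ⊑-trans : ∀ {p q s} → p ⊑[ k ] q → q ⊑[ k ] s → p ⊑[ k ] s
    ⊑-trans p⊑q q⊑s = incl λ A bA → transfer q⊑s A bA ∘ transfer p⊑q A bA

    ≤⇒⊑ : ∀ {M w v} → w ≤ v → (M , w) ⊑[ k ] (M , v)
    ≤⇒⊑ {M} w≤v = incl λ A _ → persist M w≤v A

    ~-reflexive : ∀ {p q} → p ≡ q → p ~[ k ] q
    ~-reflexive refl = ~-refl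

  record Bisimulation (k : ℕ) (Z : Point → Point → Set) : Set where
    field
      atoms : ∀ {p q} → Z p q → ∀ x → x < k → (p ⊩ var x) iff (q ⊩ var x)
      forth : ∀ {M w N v} → Z (M , w) (N , v) → ∀ w' → w ≤ w' →
              ∃ λ v' → v ≤ v' × Z (M , w') (N , v')
      back  : ∀ {M w N v} → Z (M , w) (N , v) → ∀ v' → v ≤ v' →
              ∃ λ w' → w ≤ w' × Z (M , w') (N , v')

    go : ∀ {p q} → Z p q → ∀ A → Below k A → (p ⊩ A) iff (q ⊩ A)
    go z (var x) x<k = atoms z x x<k
    go z ⊥̇ _ = id , id
    go z (A ∧ B) (bA , bB) =
      (λ (⊩A , ⊩B) → proj₁ (go z A bA) ⊩A , proj₁ (go z B bB) ⊩B) ,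
      (λ (⊩A , ⊩B) → proj₂ (go z A bA) ⊩A , proj₂ (go z B bB) ⊩B)
    go z (A ∨ B) (bA , bB) =
      Sum.map (proj₁ (go z A bA)) (proj₁ (go z B bB)) ,
      Sum.map (proj₂ (go z A bA)) (proj₂ (go z B bB))
    go z (A ⇒ B) (bA , bB) =
      (λ ⊩A⇒B v' v≤v' ⊩A → let (w' , w≤w' , z') = back z v' v≤v' in
        proj₁ (go z' B bB) (⊩A⇒B w' w≤w' (proj₂ (go z' A bA) ⊩A))) ,
      (λ ⊩A⇒B w' w≤w' ⊩A → let (v' , v≤v' , z') = forth z w' w≤w' in
        proj₂ (go z' B bB) (⊩A⇒B v' v≤v' (proj₁ (go z' A bA) ⊩A)))

    bisimilar⇒~ : ∀ {p q} → Z p q → p ~[ k ] q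
    bisimilar⇒~ z = equiv (go z)

  -- A bisimulation in one step: proper successors are matched by equivalences known already, while
  -- the two points may be matched with each other, the circularity being absorbed by induction on
  -- the formula.
  ~-step : ∀ {k M w N v} →
           (∀ x → x < k → T (val M x w) iff T (val N x v)) →
           (∀ w' → w ≤ w' → w' ≡ w ⊎ ∃ λ v' → v ≤ v' × (M , w') ~[ k ] (N , v')) →
           (∀ v' → v ≤ v' → v' ≡ v ⊎ ∃ λ w' → w ≤ w' × (M , w') ~[ k ] (N , v')) →
           (M , w) ~[ k ] (N , v)
  ~-step {k} {M} {w} {N} {v} atoms forth back = equiv go
    where
    go : ∀ A → Below k A → ((M , w) ⊩ A) iff ((N , v) ⊩ A)
    go (var x) x<k = atoms x x<k
    go ⊥̇ _ = id , id
    go (A ∧ B) (bA , bB) =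
      (λ (⊩A , ⊩B) → proj₁ (go A bA) ⊩A , proj₁ (go B bB) ⊩B) ,
      (λ (⊩A , ⊩B) → proj₂ (go A bA) ⊩A , proj₂ (go B bB) ⊩B)
    go (A ∨ B) (bA , bB) =
      Sum.map (proj₁ (go A bA)) (proj₁ (go B bB)) ,
      Sum.map (proj₂ (go A bA)) (proj₂ (go B bB))
    go (A ⇒ B) (bA , bB) =
      (λ ⊩A⇒B v' v≤v' → there⇒ ⊩A⇒B v' (back v' v≤v')) ,
      (λ ⊩A⇒B w' w≤w' → here⇒ ⊩A⇒B w' (forth w' w≤w'))
      where
      there⇒ : (M , w) ⊩ (A ⇒ B) → ∀ v' → v' ≡ v ⊎ (∃ λ w' → w ≤ w' × (M , w') ~[ k ] (N , v')) →
               (N , v') ⊩ A → (N , v') ⊩ B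
      there⇒ ⊩A⇒B v' (inj₁ refl) ⊩A = proj₁ (go B bB) (⊩A⇒B w ≤-refl (proj₂ (go A bA) ⊩A))
      there⇒ ⊩A⇒B v' (inj₂ (w' , w≤w' , w'~v')) ⊩A =
        proj₁ (agree w'~v' B bB) (⊩A⇒B w' w≤w' (proj₂ (agree w'~v' A bA) ⊩A))
      here⇒ : (N , v) ⊩ (A ⇒ B) → ∀ w' → w' ≡ w ⊎ (∃ λ v' → v ≤ v' × (M , w') ~[ k ] (N , v')) →
              (M , w') ⊩ A → (M , w') ⊩ B
      here⇒ ⊩A⇒B w' (inj₁ refl) ⊩A = proj₂ (go B bB) (⊩A⇒B v ≤-refl (proj₁ (go A bA) ⊩A))
      here⇒ ⊩A⇒B w' (inj₂ (v' , v≤v' , w'~v')) ⊩A =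
        proj₂ (agree w'~v' B bB) (⊩A⇒B v' v≤v' (proj₁ (agree w'~v' A bA) ⊩A))

  UpSet : Set
  UpSet = Σ (W → Bool) λ S → ∀ {w v} → w ≤ v → T (S w) → T (S v)

  upset-cons : W → UpSet → UpSet
  upset-cons u (S , S↑) = (λ w → isYes (u ≤? w) || S w) , λ {w} {v} w≤v t →
    Equivalence.from (T-∨ {isYes (u ≤? v)})
      (Sum.map (λ u≤w → fromWitness (≤-trans (toWitness u≤w) w≤v)) (S↑ w≤v)
        (Equivalence.to (T-∨ {isYes (u ≤? w)}) t))

  generatedUpsets : List W → List UpSet
  generatedUpsets []       = ((λ _ → false) , λ _ ()) ∷ []
  generatedUpsets (u ∷ us) = generatedUpsets us ++ map (upset-cons u) (generatedUpsets us)

  -- For arbitrary `S` the list contains the up-set generated by the part of `S` inside `us`; when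
  -- `S` is monotone and `us` is all of `worlds`, this is `S` itself.
  generatedUpsets-complete : (S : W → Bool) → ∀ us → Any (λ (S' , _) →
    ∀ w → T (S' w) iff (∃ λ u → u ∈ us × T (S u) × u ≤ w)) (generatedUpsets us)
  generatedUpsets-complete S [] = here λ w → (λ ()) , λ ()
  generatedUpsets-complete S (u ∷ us) with find (generatedUpsets-complete S us)
  ... | (S' , S'↑) , ∈ups , S'-spec with T? (S u)
  ... | no ¬Su = lose (∈-++⁺ˡ ∈ups) λ w →
          (λ t → let (v , v∈ , Sv , v≤w) = proj₁ (S'-spec w) t in v , there v∈ , Sv , v≤w) ,
          λ { (_ , here refl , Su , _)  → contradiction Su ¬Su
            ; (v , there v∈ , Sv , v≤w) → proj₂ (S'-spec w) (v , v∈ , Sv , v≤w) }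
  ... | yes Su = lose (∈-++⁺ʳ (generatedUpsets us) (∈-map⁺ (upset-cons u) ∈ups)) λ w →
          (λ t → [ (λ u≤w → u , here refl , Su , toWitness u≤w)
                 , (λ t' → let (v , v∈ , Sv , v≤w) = proj₁ (S'-spec w) t' in v , there v∈ , Sv , v≤w)
                 ]′ (Equivalence.to (T-∨ {isYes (u ≤? w)}) t)) ,
          λ { (_ , here refl , _ , u≤w) → Equivalence.from (T-∨ {isYes (u ≤? w)}) (inj₁ (fromWitness u≤w))
            ; (v , there v∈ , Sv , v≤w) → Equivalence.from (T-∨ {isYes (u ≤? w)})
                                            (inj₂ (proj₂ (S'-spec w) (v , v∈ , Sv , v≤w))) }

  override : ℕ → UpSet → Model → Model
  override k (S , S↑) M = model val' mono'
    where
    val' : Valuation frame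
    val' x w with x ≡ᵇ k
    ... | true  = S w
    ... | false = val M x w
    mono' : Monotone frame val'
    mono' x w≤v with x ≡ᵇ k
    ... | true  = S↑ w≤v
    ... | false = mono M x w≤v

  SameColours : ℕ → Model → Model → Set
  SameColours k M N = ∀ x → x < k → ∀ w → T (val M x w) iff T (val N x w)

  abstract
    models : ℕ → List Model
    models zero    = model (λ _ _ → false) (λ _ _ ()) ∷ []
    models (suc k) = cartesianProductWith (override k) (generatedUpsets worlds) (models k)

    models-complete : ∀ k M → ∃ λ N → N ∈ models k × SameColours k M N
    models-complete zero    M = _ , here refl , λ _ ()
    models-complete (suc k) M
      with models-complete k M | find (generatedUpsets-complete (val M k) worlds)
    ... | N , N∈ , same | S , S∈ , S-spec =
      override k S N , ∈-cartesianProductWith⁺ (override k) S∈ N∈ , same′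
      where
      same′ : SameColours (suc k) M (override k S N)
      same′ x x<1+k w with x ≡ᵇ k in eq
      ... | true  with refl ← ≡ᵇ⇒≡ x k (subst T (sym eq) tt) =
            (λ t → proj₂ (S-spec w) (w , ∈-worlds w , t , ≤-refl)) ,
            (λ t → let (u , _ , Su , u≤w) = proj₁ (S-spec w) t in mono M k u≤w Su)
      ... | false with m<1+n⇒m<n∨m≡n x<1+k
      ...   | inj₁ x<k  = same x x<k w
      ...   | inj₂ refl = ⊥-elim (subst T eq (≡⇒≡ᵇ k k refl))

  same⇒~ : ∀ {k M N} → SameColours k M N → ∀ w → (M , w) ~[ k ] (N , w)
  same⇒~ {k} {M} {N} same w = Bisimulation.bisimilar⇒~ identity (refl , refl , refl)
    where
    identity : Bisimulation k (λ (M' , v) (N' , v') → M' ≡ M × N' ≡ N × v ≡ v')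
    identity = record
      { atoms = λ { (refl , refl , refl) x x<k → same x x<k _ }
      ; forth = λ { (refl , refl , refl) w' w≤w' → w' , w≤w' , refl , refl , refl }
      ; back  = λ { (refl , refl , refl) w' w≤w' → w' , w≤w' , refl , refl , refl } }

  abstract
    points : ℕ → List Point
    points k = cartesianProductWith _,_ (models k) worlds

    points-complete : ∀ k M w → ∃ λ N → (N , w) ∈ points k × (M , w) ~[ k ] (N , w)
    points-complete k M w with models-complete k M
    ... | N , N∈ , same = N , ∈-cartesianProductWith⁺ _,_ N∈ (∈-worlds w) , same⇒~ same w

-- Local finiteness, and definability of upward closed properties.

map-≡-∈ : ∀ {A B : Set} {f g : A → B} {x} xs → map f xs ≡ map g xs → x ∈ xs → f x ≡ g x
map-≡-∈ (y ∷ ys) eq (here refl) = ∷-injectiveˡ eq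
map-≡-∈ (y ∷ ys) eq (there x∈)  = map-≡-∈ ys (∷-injectiveʳ eq) x∈

isYes-injective : ∀ {P Q : Set} (P? : Dec P) (Q? : Dec Q) → isYes P? ≡ isYes Q? → P iff Q
isYes-injective (yes p) (yes q) _ = (λ _ → q) , (λ _ → p)
isYes-injective (no ¬p) (no ¬q) _ = (λ p → contradiction p ¬p) , (λ q → contradiction q ¬q)

boolLists : ℕ → List (List Bool)
boolLists zero    = [] ∷ []
boolLists (suc n) = map (true ∷_) (boolLists n) ++ map (false ∷_) (boolLists n)

map∈boolLists : ∀ {A : Set} (f : A → Bool) xs → map f xs ∈ boolLists (length xs)
map∈boolLists f []       = here refl
map∈boolLists f (x ∷ xs) with f x
... | true  = ∈-++⁺ˡ (∈-map⁺ (true ∷_) (map∈boolLists f xs))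
... | false = ∈-++⁺ʳ (map (true ∷_) (boolLists (length xs))) (∈-map⁺ (false ∷_) (map∈boolLists f xs))

⋀ ⋁ : List Fm → Fm
⋀ []       = ⊥̇ ⇒ ⊥̇
⋀ (A ∷ As) = A ∧ ⋀ As
⋁ []       = ⊥̇
⋁ (A ∷ As) = A ∨ ⋁ As

⋀-below : ∀ {k As} → All (Below k) As → Below k (⋀ As)
⋀-below []         = tt , tt
⋀-below (bA ∷ bAs) = bA , ⋀-below bAs

⋁-below : ∀ {k As} → All (Below k) As → Below k (⋁ As)
⋁-below []         = tt
⋁-below (bA ∷ bAs) = bA , ⋁-below bAs

module LocalFiniteness (FF : FiniteFrame) where
  open FiniteFrame FF
  open Kripke FF

  ⊩⋀ : ∀ p As → (p ⊩ ⋀ As) iff All (p ⊩_) As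
  ⊩⋀ p []       = (λ _ → []) , λ _ _ _ ()
  ⊩⋀ p (A ∷ As) = (λ (⊩A , ⊩As) → ⊩A ∷ proj₁ (⊩⋀ p As) ⊩As)
                , λ { (⊩A ∷ ⊩As) → ⊩A , proj₂ (⊩⋀ p As) ⊩As }

  ⊩⋁ : ∀ p As → (p ⊩ ⋁ As) iff Any (p ⊩_) As
  ⊩⋁ p []       = (λ ()) , λ ()
  ⊩⋁ p (A ∷ As) = (λ { (inj₁ ⊩A) → here ⊩A ; (inj₂ ⊩As) → there (proj₁ (⊩⋁ p As) ⊩As) })
                , λ { (here ⊩A) → inj₁ ⊩A ; (there ⊩As) → inj₂ (proj₂ (⊩⋁ p As) ⊩As) }

  infix 3 _≃_
  _≃_ : Fm → Fm → Set
  A ≃ B = ∀ p → (p ⊩ A) iff (p ⊩ B)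

  module _ (k : ℕ) where

    truth : Fm → List Bool
    truth A = map (λ p → isYes (p ⊩? A)) (points k)

    -- Every point agrees with an enumerated one on formulas over `k` variables, so a finite truth
    -- list determines such a formula up to equivalence.
    truth≡⇒≃ : ∀ {A B} → Below k A → Below k B → truth A ≡ truth B → A ≃ B
    truth≡⇒≃ {A} {B} bA bB eq (M , w) with points-complete k M w
    ... | N , ∈pts , ~N =
      (λ ⊩A → proj₂ (agree ~N B bB) (proj₁ A⇔B (proj₁ (agree ~N A bA) ⊩A))) ,
      (λ ⊩B → proj₂ (agree ~N A bA) (proj₂ A⇔B (proj₁ (agree ~N B bB) ⊩B)))
      where
      A⇔B : ((N , w) ⊩ A) iff ((N , w) ⊩ B)
      A⇔B = isYes-injective ((N , w) ⊩? A) ((N , w) ⊩? B) (map-≡-∈ (points k) eq ∈pts)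

    step : List Fm → List Fm
    step As = ⊥̇ ∷ map var (upTo k) ++ cartesianProductWith _∧_ As As
                ++ cartesianProductWith _∨_ As As ++ cartesianProductWith _⇒_ As As

    step-below : ∀ As → All (Below k) As → All (Below k) (step As)
    step-below As bAs =
      tt ∷ All-++⁺ (All-map⁺ (All.tabulate ∈-upTo⁻))
          (All-++⁺ (pairs _∧_ _,_) (All-++⁺ (pairs _∨_ _,_) (pairs _⇒_ _,_)))
      where
      pairs : (_⊗_ : Fm → Fm → Fm) → (∀ {A B} → Below k A → Below k B → Below k (A ⊗ B)) →
              All (Below k) (cartesianProductWith _⊗_ As As)
      pairs _⊗_ b⊗ = All.tabulate λ A⊗B∈ → lemma (∈-cartesianProductWith⁻ _⊗_ As As A⊗B∈)
        where
        lemma : ∀ {C} → (∃ λ A → ∃ λ B → A ∈ As × B ∈ As × C ≡ (A ⊗ B)) → Below k C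
        lemma (A , B , A∈ , B∈ , refl) = b⊗ (All.lookup bAs A∈) (All.lookup bAs B∈)

    Hit : List Fm → Fm → Set
    Hit As A = Any (λ B → truth A ≡ truth B) As

    hit? : ∀ As → Decidable (Hit As)
    hit? As A = any? (λ B → ≡-dec _≟ᵇ_ (truth A) (truth B)) As

    -- Every round adds a formula with a new truth list; `rem` bounds the truth lists not yet met.
    saturate : ∀ fuel rem As → length rem ≤ⁿ fuel → All (Below k) As →
               (∀ A → truth A ∈ rem ⊎ Hit As A) →
               ∃ λ Bs → All (Below k) Bs × All (Hit Bs) (step Bs)
    saturate fuel rem As rem≤ bAs cover with all? (hit? As) (step As)
    ... | yes closed = As , bAs , closed
    ... | no ¬closed with find (¬All⇒Any¬ (hit? As) (step As) ¬closed)
    ...   | A , A∈ , ¬hit with cover A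
    ...     | inj₂ hit = contradiction hit ¬hit
    saturate (suc fuel) rem As rem≤ bAs cover | no ¬closed | A , A∈ , ¬hit | inj₁ A∈rem =
      saturate fuel (filter (λ v → ¬? (≡-dec _≟ᵇ_ v (truth A))) rem) (A ∷ As)
        (≤-pred (<-≤-trans (filter-notAll (λ v → ¬? (≡-dec _≟ᵇ_ v (truth A))) rem
                             (lose A∈rem λ ≢ → ≢ refl)) rem≤))
        (All.lookup (step-below As bAs) A∈ ∷ bAs)
        cover′
      where
      cover′ : ∀ B → truth B ∈ filter (λ v → ¬? (≡-dec _≟ᵇ_ v (truth A))) rem ⊎ Hit (A ∷ As) B
      cover′ B with ≡-dec _≟ᵇ_ (truth B) (truth A)
      ... | yes eq = inj₂ (here eq)
      ... | no ≢   = Sum.map (λ ∈rem → ∈-filter⁺ (λ v → ¬? (≡-dec _≟ᵇ_ v (truth A))) ∈rem ≢) there (cover B)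
    saturate zero [] As rem≤ bAs cover | no ¬closed | A , A∈ , ¬hit | inj₁ ()

    abstract
      saturated : ∃ λ Bs → All (Below k) Bs × All (Hit Bs) (step Bs)
      -- Nothing is collected at first, and every Boolean list of the right length counts as not yet
      -- met.
      saturated = saturate _ (boolLists (length (points k))) [] ≤ⁿ-refl []
                    (λ A → inj₁ (map∈boolLists _ (points k)))

    formulas : List Fm
    formulas = proj₁ saturated

    formulas-below : All (Below k) formulas
    formulas-below = proj₁ (proj₂ saturated)

    ∈-step⇒≃ : ∀ {A} → A ∈ step formulas → ∃ λ B → B ∈ formulas × A ≃ B
    ∈-step⇒≃ A∈ with find (All.lookup (proj₂ (proj₂ saturated)) A∈)
    ... | B , B∈ , eq = B , B∈ , truth≡⇒≃ (All.lookup (step-below formulas formulas-below) A∈)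
                                          (All.lookup formulas-below B∈) eq

    formulas-complete : ∀ A → Below k A → ∃ λ B → B ∈ formulas × A ≃ B
    formulas-complete (var x) x<k = ∈-step⇒≃ (there (∈-++⁺ˡ (∈-map⁺ var (∈-upTo⁺ x<k))))
    formulas-complete ⊥̇ _ = ∈-step⇒≃ (here refl)
    formulas-complete (A ∧ B) (bA , bB) with formulas-complete A bA | formulas-complete B bB
    ... | A' , A'∈ , A≃ | B' , B'∈ , B≃
      with ∈-step⇒≃ (there (∈-++⁺ʳ (map var (upTo k)) (∈-++⁺ˡ (∈-cartesianProductWith⁺ _∧_ A'∈ B'∈))))
    ... | C , C∈ , C≃ = C , C∈ , λ p →
      (λ (⊩A , ⊩B) → proj₁ (C≃ p) (proj₁ (A≃ p) ⊩A , proj₁ (B≃ p) ⊩B)) ,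
      (λ ⊩C → let (⊩A , ⊩B) = proj₂ (C≃ p) ⊩C in proj₂ (A≃ p) ⊩A , proj₂ (B≃ p) ⊩B)
    formulas-complete (A ∨ B) (bA , bB) with formulas-complete A bA | formulas-complete B bB
    ... | A' , A'∈ , A≃ | B' , B'∈ , B≃
      with ∈-step⇒≃ (there (∈-++⁺ʳ (map var (upTo k)) (∈-++⁺ʳ (cartesianProductWith _∧_ formulas formulas)
             (∈-++⁺ˡ (∈-cartesianProductWith⁺ _∨_ A'∈ B'∈)))))
    ... | C , C∈ , C≃ = C , C∈ , λ p →
      (λ ⊩A∨B → proj₁ (C≃ p) (Sum.map (proj₁ (A≃ p)) (proj₁ (B≃ p)) ⊩A∨B)) ,
      (λ ⊩C → Sum.map (proj₂ (A≃ p)) (proj₂ (B≃ p)) (proj₂ (C≃ p) ⊩C))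
    formulas-complete (A ⇒ B) (bA , bB) with formulas-complete A bA | formulas-complete B bB
    ... | A' , A'∈ , A≃ | B' , B'∈ , B≃
      with ∈-step⇒≃ (there (∈-++⁺ʳ (map var (upTo k)) (∈-++⁺ʳ (cartesianProductWith _∧_ formulas formulas)
             (∈-++⁺ʳ (cartesianProductWith _∨_ formulas formulas)
               (∈-cartesianProductWith⁺ _⇒_ A'∈ B'∈)))))
    ... | C , C∈ , C≃ = C , C∈ , λ { p@(M , w) →
      (λ ⊩A⇒B → proj₁ (C≃ p) λ v w≤v ⊩A' → proj₁ (B≃ (M , v)) (⊩A⇒B v w≤v (proj₂ (A≃ (M , v)) ⊩A'))) ,
      (λ ⊩C v w≤v ⊩A → proj₂ (B≃ (M , v)) (proj₂ (C≃ p) ⊩C v w≤v (proj₁ (A≃ (M , v)) ⊩A))) }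

    ⊑-via : ∀ {p q} → (∀ {A} → A ∈ formulas → p ⊩ A → q ⊩ A) → p ⊑[ k ] q
    ⊑-via {p} {q} f = incl λ A bA ⊩A → let (B , B∈ , A≃B) = formulas-complete A bA in
      proj₂ (A≃B q) (f B∈ (proj₁ (A≃B p) ⊩A))

    abstract
      _⊑?_ : ∀ p q → Dec (p ⊑[ k ] q)
      p ⊑? q = map′ (λ all → ⊑-via (All.lookup all))
                    (λ p⊑q → All.tabulate λ {A} A∈ → transfer p⊑q A (All.lookup formulas-below A∈))
                    (all? (λ A → (p ⊩? A) →-dec (q ⊩? A)) formulas)

    ⊑-antisym : ∀ {p q} → p ⊑[ k ] q → q ⊑[ k ] p → p ~[ k ] q
    ⊑-antisym p⊑q q⊑p = equiv λ A bA → transfer p⊑q A bA , transfer q⊑p A bA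

    abstract
      _~?_ : ∀ p q → Dec (p ~[ k ] q)
      p ~? q = map′ (λ (p⊑q , q⊑p) → ⊑-antisym p⊑q q⊑p) (λ p~q → ~⇒⊑ p~q , ~⇒⊒ p~q) ((p ⊑? q) ×-dec (q ⊑? p))

    diagram : Point → Fm
    diagram p = ⋀ (filter (p ⊩?_) formulas)

    diagram-below : ∀ p → Below k (diagram p)
    diagram-below p = ⋀-below (All.tabulate λ A∈ →
      All.lookup formulas-below (proj₁ (∈-filter⁻ (p ⊩?_) {xs = formulas} A∈)))

    ⊩diagram⇒⊑ : ∀ {p q} → q ⊩ diagram p → p ⊑[ k ] q
    ⊩diagram⇒⊑ {p} {q} ⊩d = ⊑-via λ A∈ ⊩A →
      All.lookup (proj₁ (⊩⋀ q (filter (p ⊩?_) formulas)) ⊩d) (∈-filter⁺ (p ⊩?_) A∈ ⊩A)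

    ⊑⇒⊩diagram : ∀ {p q} → p ⊑[ k ] q → q ⊩ diagram p
    ⊑⇒⊩diagram {p} {q} p⊑q = proj₂ (⊩⋀ q (filter (p ⊩?_) formulas)) (All.tabulate λ {A} A∈ →
      let (A∈' , ⊩A) = ∈-filter⁻ (p ⊩?_) {xs = formulas} A∈ in
      transfer p⊑q A (All.lookup formulas-below A∈') ⊩A)

    -- Together with `diagram q` it characterises the class of `q`: a point that forces `diagram q`
    -- but not `omitted q` satisfies the same formulas over `k` variables as `q`.
    omitted : Point → Fm
    omitted q = ⋁ (filter (λ A → ¬? (q ⊩? A)) formulas)

    omitted-below : ∀ q → Below k (omitted q)
    omitted-below q = ⋁-below (All.tabulate λ A∈ →
      All.lookup formulas-below (proj₁ (∈-filter⁻ (λ A → ¬? (q ⊩? A)) {xs = formulas} A∈)))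

    ⊮omitted : ∀ q → ¬ (q ⊩ omitted q)
    ⊮omitted q ⊩o with find (proj₁ (⊩⋁ q (filter (λ A → ¬? (q ⊩? A)) formulas)) ⊩o)
    ... | A , A∈ , ⊩A = proj₂ (∈-filter⁻ (λ A → ¬? (q ⊩? A)) {xs = formulas} A∈) ⊩A

    abstract
      -- p refutes `diagram q ⇒ omitted q` because q does; a counterexample above p is equivalent to q.
      ⊑⇒above~ : ∀ {M w q} → (M , w) ⊑[ k ] q → ∃ λ v → w ≤ v × (M , v) ~[ k ] q
      ⊑⇒above~ {M} {w} {q} p⊑q
        with ⊮⇒-counterexample M w (diagram q) (omitted q) (λ p⊩ → ⊮omitted q
               (transfer p⊑q (diagram q ⇒ omitted q) (diagram-below q , omitted-below q) p⊩
                 (proj₂ q) ≤-refl (⊑⇒⊩diagram (~⇒⊑ ~-refl))))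
      ... | v , w≤v , ⊩d , ⊮o = v , w≤v , ⊑-antisym
        (⊑-via λ {A} A∈ v⊩A → decidable-stable (q ⊩? A) λ q⊮A →
          ⊮o (proj₂ (⊩⋁ (M , v) (filter (λ A → ¬? (q ⊩? A)) formulas))
               (lose (∈-filter⁺ (λ A → ¬? (q ⊩? A)) A∈ q⊮A) v⊩A)))
        (⊩diagram⇒⊑ ⊩d)

    -- A property closed under `⊑` is the union of the cones above the enumerated points having it,
    -- and the cone above a point is defined by its `diagram`.
    module Definable {S : Point → Set} (S? : Decidable S)
                     (S-up : ∀ {p q} → p ⊑[ k ] q → S p → S q) where

      abstract
        formula : Fm
        formula = ⋁ (map diagram (filter S? (points k)))

        formula-below : Below k formula
        formula-below = ⋁-below (All-map⁺ (All.tabulate λ {p} _ → diagram-below p))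

        ⊩formula : ∀ p → (p ⊩ formula) iff S p
        ⊩formula p@(M , w) = to , from
          where
          to : p ⊩ formula → S p
          to p⊩f with find (proj₁ (⊩⋁ p (map diagram (filter S? (points k)))) p⊩f)
          ... | _ , A∈ , ⊩A with ∈-map⁻ diagram A∈
          ... | q , q∈ , refl = S-up (⊩diagram⇒⊑ ⊩A) (proj₂ (∈-filter⁻ S? {xs = points k} q∈))
          from : S p → p ⊩ formula
          from Sp with points-complete k M w
          ... | N , ∈pts , p~ = proj₂ (⊩⋁ p (map diagram (filter S? (points k))))
            (lose (∈-map⁺ diagram (∈-filter⁺ S? ∈pts (S-up (~⇒⊑ p~) Sp))) (⊑⇒⊩diagram (~⇒⊒ p~)))

  logic? : ∀ A → Dec (LogicOf frame A)
  logic? A = map′ (λ all V V↑ w → let (N , ∈pts , p~) = points-complete (bound A) (model V V↑) w in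
                      proj₂ (agree p~ A (below-bound A)) (All.lookup all ∈pts))
                  (λ L → All.tabulate λ { {M , w} _ → L (val M) (mono M) w })
                  (all? (_⊩? A) (points (bound A)))

-- The shapes of worlds: maximal points, forks and two kinds of roots.

module Shapes (FF : FiniteFrame) where
  open FiniteFrame FF
  open Kripke FF

  Colour : Set
  Colour = ℕ → Bool

  _∙_≐_ : Model → W → Colour → Set
  M ∙ w ≐ u = ∀ x → val M x w ≡ u x

  _⊓_ : Colour → Colour → Colour
  (u ⊓ v) x = u x && v x

  Maximal : W → Set
  Maximal w = ∀ v → w ≤ v → v ≡ w

  -- `paint` says that colours can be prescribed freely, up to the meet that monotonicity forces at
  -- `w`. In particular the two prongs are distinct.
  record Fork (w v₁ v₂ : W) : Set where
    field
      max₁  : Maximal v₁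
      max₂  : Maximal v₂
      w≤v₁  : w ≤ v₁
      w≤v₂  : w ≤ v₂
      cover : ∀ v → w ≤ v → v ≡ w ⊎ v ≡ v₁ ⊎ v ≡ v₂
      paint : ∀ u u₁ u₂ → ∃ λ M → M ∙ w ≐ (u ⊓ (u₁ ⊓ u₂)) × M ∙ v₁ ≐ u₁ × M ∙ v₂ ≐ u₂

  -- The root of `𝔊₂`. `paint` leaves the colour of `w` open, because an amalgam at a root is
  -- constrained only strictly above it.
  record Root₁ (w v s s₁ s₂ : W) : Set where
    field
      maxᵥ  : Maximal v
      fork  : Fork s s₁ s₂
      w≤v   : w ≤ v
      w≤s   : w ≤ s
      cover : ∀ y → w ≤ y → y ≡ w ⊎ y ≡ v ⊎ s ≤ y
      paint : ∀ u x u₁ u₂ → ∃ λ M → M ∙ v ≐ u × M ∙ s ≐ (x ⊓ (u₁ ⊓ u₂)) × M ∙ s₁ ≐ u₁ × M ∙ s₂ ≐ u₂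

  -- The root of `ℭ₅`: the two forks share the prong `m`, so they cannot be painted independently.
  record Root₂ (w v s m v₁ s₁ : W) : Set where
    field
      forkᵥ : Fork v m v₁
      forkₛ : Fork s m s₁
      w≤v   : w ≤ v
      w≤s   : w ≤ s
      cover : ∀ y → w ≤ y → y ≡ w ⊎ v ≤ y ⊎ s ≤ y
      paint : ∀ x y u u₁ u₂ → ∃ λ M → M ∙ v ≐ (x ⊓ (u ⊓ u₁)) × M ∙ s ≐ (y ⊓ (u ⊓ u₂))
                × M ∙ m ≐ u × M ∙ v₁ ≐ u₁ × M ∙ s₁ ≐ u₂

  data Kind (w : W) : Set where
    maximal : Maximal w → Kind w
    fork    : ∀ v₁ v₂ → Fork w v₁ v₂ → Kind w
    root₁   : ∀ v s s₁ s₂ → Root₁ w v s s₁ s₂ → Kind w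
    root₂   : ∀ v s m v₁ s₁ → Root₂ w v s m v₁ s₁ → Kind w

  Fork-swap : ∀ {w v₁ v₂} → Fork w v₁ v₂ → Fork w v₂ v₁
  Fork-swap F = record
    { max₁ = max₂ ; max₂ = max₁ ; w≤v₁ = w≤v₂ ; w≤v₂ = w≤v₁
    ; cover = λ v w≤v → Sum.map₂ Sum.swap (cover v w≤v)
    ; paint = λ u u₁ u₂ → let (M , M≐ , M≐₁ , M≐₂) = paint u u₂ u₁ in
        M , (λ x → trans (M≐ x) (cong (u x &&_) (∧-comm (u₂ x) (u₁ x)))) , M≐₂ , M≐₁ }
    where open Fork F

record AmalgamationFrame : Set₁ where
  field finite : FiniteFrame
  open FiniteFrame finite public
  open Shapes finite public
  field
    kind  : ∀ w → Kind w
    -- Up to equivalence, every maximal point occurs at α₁ and every fork at ψ.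
    ψ α₁ α₂ : W
    ψ-fork  : Fork ψ α₁ α₂

nth : ∀ {A : Set} → A → List A → ℕ → A
nth z []       _       = z
nth z (x ∷ xs) zero    = x
nth z (x ∷ xs) (suc j) = nth z xs j

∈⇒nth : ∀ {A : Set} {z y : A} {xs} → y ∈ xs → ∃ λ j → j < length xs × nth z xs j ≡ y
∈⇒nth (here refl) = 0 , s≤s z≤n , refl
∈⇒nth (there y∈)  = let (j , j< , eq) = ∈⇒nth y∈ in suc j , s≤s j< , eq

-- Peaks, shallow points and roots, up to equivalence.

module ShapeLemmas (AF : AmalgamationFrame) where
  open AmalgamationFrame AF
  open Kripke finite
  open LocalFiniteness finite

  abstract
    top : ∀ w → ∃ λ v → w ≤ v × Maximal v
    top w with kind w
    ... | maximal max            = w , ≤-refl , max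
    ... | fork v₁ _ F            = v₁ , Fork.w≤v₁ F , Fork.max₁ F
    ... | root₁ v _ _ _ R        = v , Root₁.w≤v R , Root₁.maxᵥ R
    ... | root₂ v _ m _ _ R      = m , ≤-trans (Root₂.w≤v R) (Fork.w≤v₁ (Root₂.forkᵥ R)) , Fork.max₁ (Root₂.forkᵥ R)

  iff-≡ : ∀ {u v : Bool} → u ≡ v → T u iff T v
  iff-≡ refl = id , id

  module _ {k : ℕ} where

    abstract
      max~ : ∀ {M w N v} → Maximal w → Maximal v →
             (∀ x → x < k → T (val M x w) iff T (val N x v)) → (M , w) ~[ k ] (N , v)
      max~ maxw maxv atoms = ~-step atoms (λ w' w≤ → inj₁ (maxw w' w≤)) (λ v' v≤ → inj₁ (maxv v' v≤))

      max-⊑⇒~ : ∀ {M w q} → Maximal w → (M , w) ⊑[ k ] q → (M , w) ~[ k ] q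
      max-⊑⇒~ maxw p⊑q with ⊑⇒above~ k p⊑q
      ... | v , w≤v , v~q with refl ← maxw v w≤v = v~q

      max~-up : ∀ {M w N v u} → Maximal w → (M , w) ~[ k ] (N , v) → v ≤ u → (M , w) ~[ k ] (N , u)
      max~-up maxw w~v v≤u = max-⊑⇒~ maxw (⊑-trans (~⇒⊑ w~v) (≤⇒⊑ v≤u))

      fork~ : ∀ {M w w₁ w₂ N v v₁ v₂} → Fork w w₁ w₂ → Fork v v₁ v₂ →
              (∀ x → x < k → T (val M x w) iff T (val N x v)) →
              (M , w₁) ~[ k ] (N , v₁) → (M , w₂) ~[ k ] (N , v₂) → (M , w) ~[ k ] (N , v)
      fork~ {M} {w} {w₁} {w₂} {N} {v} {v₁} {v₂} F F' atoms ~₁ ~₂ = ~-step atoms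
        (λ w' w≤ → Sum.map₂ [ (λ { refl → v₁ , Fork.w≤v₁ F' , ~₁ }) , (λ { refl → v₂ , Fork.w≤v₂ F' , ~₂ }) ]′
                            (Fork.cover F w' w≤))
        (λ v' v≤ → Sum.map₂ [ (λ { refl → w₁ , Fork.w≤v₁ F , ~₁ }) , (λ { refl → w₂ , Fork.w≤v₂ F , ~₂ }) ]′
                            (Fork.cover F' v' v≤))

  ⊓-absorb : ∀ M {w v₁ v₂} → w ≤ v₁ → w ≤ v₂ → ∀ x →
             T (val M x w && (val M x v₁ && val M x v₂)) iff T (val M x w)
  ⊓-absorb M w≤v₁ w≤v₂ x =
    (λ t → proj₁ (Equivalence.to T-∧ t)) ,
    (λ t → Equivalence.from T-∧ (t , Equivalence.from T-∧ (mono M x w≤v₁ t , mono M x w≤v₂ t)))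

  ≐⇒atom : ∀ {M w u k N v} → M ∙ w ≐ u → (∀ x → x < k → T (u x) iff T (val N x v)) →
           ∀ x → x < k → T (val M x w) iff T (val N x v)
  ≐⇒atom M≐u u⇔ x x<k rewrite M≐u x = u⇔ x x<k

  colour : Model → W → Colour
  colour M w x = val M x w

  module _ {w w₁ w₂ : W} (F : Fork w w₁ w₂) where
    open Fork F

    abstract
      -- Painting with the actual colours loses nothing to the meets, by `⊓-absorb`. Besides the
      -- bottom of a fork, `v` may be a maximal point equal to `v₁` and `v₂`, as in `repaint-max`,
      -- or a root with collapsing sides, as in `rooted`.
      repaint : ∀ k N {v v₁ v₂} → v ≤ v₁ → v ≤ v₂ → Maximal v₁ → Maximal v₂ →
                ∃ λ M → (∀ x → x < k → T (val M x w) iff T (val N x v))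
                      × (M , w₁) ~[ k ] (N , v₁) × (M , w₂) ~[ k ] (N , v₂)
      repaint k N {v} {v₁} {v₂} v≤v₁ v≤v₂ maxv₁ maxv₂
        with paint (colour N v) (colour N v₁) (colour N v₂)
      ... | M , M≐ , M≐₁ , M≐₂ = M , ≐⇒atom {M} {w} {N = N} M≐ (λ x _ → ⊓-absorb N v≤v₁ v≤v₂ x)
                               , max~ max₁ maxv₁ (λ x _ → iff-≡ (M≐₁ x))
                               , max~ max₂ maxv₂ (λ x _ → iff-≡ (M≐₂ x))

      repaint-fork : ∀ k N {v v₁ v₂} → Fork v v₁ v₂ →
                     ∃ λ M → (M , w) ~[ k ] (N , v) × (M , w₁) ~[ k ] (N , v₁) × (M , w₂) ~[ k ] (N , v₂)
      repaint-fork k N F' with repaint k N (Fork.w≤v₁ F') (Fork.w≤v₂ F') (Fork.max₁ F') (Fork.max₂ F')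
      ... | M , atoms , ~₁ , ~₂ = M , fork~ F F' atoms ~₁ ~₂ , ~₁ , ~₂

      repaint-max : ∀ k N {v} → Maximal v →
                    ∃ λ M → (M , w) ~[ k ] (N , v) × (M , w₁) ~[ k ] (N , v) × (M , w₂) ~[ k ] (N , v)
      repaint-max k N {v} max with repaint k N ≤-refl ≤-refl max max
      ... | M , atoms , ~₁ , ~₂ = M , ~-step atoms
            (λ w' w≤ → Sum.map₂ (λ { (inj₁ refl) → v , ≤-refl , ~₁ ; (inj₂ refl) → v , ≤-refl , ~₂ }) (cover w' w≤))
            (λ v' v≤ → inj₁ (max v' v≤)) , ~₁ , ~₂

  -- n colours for the unifier, one for shallowness, and a prong colour for every point over n variables.
  abstract
    arity : ℕ → ℕ
    arity n = suc n + length (points n)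

    n<arity : ∀ n → n < arity n
    n<arity n = s≤s (m≤m+n n _)

    index<arity : ∀ n j → j < length (points n) → suc n + j < arity n
    index<arity n j j< = +-monoʳ-< (suc n) j<

  -- Shapes are taken up to equivalence, since a root may be indistinguishable from a fork and a
  -- fork from a maximal point. Searching the enumerated models keeps these notions decidable.
  Shallow : ℕ → Point → Set
  Shallow k p = Any (λ N → (N , ψ) ~[ k ] p) (models k)

  Peak : ℕ → Point → Set
  Peak k p = Any (λ N → (N , α₁) ~[ k ] p) (models k)

  open Fork ψ-fork using () renaming (max₁ to α₁-max; max₂ to α₂-max; w≤v₁ to ψ≤α₁; w≤v₂ to ψ≤α₂; cover to ψ-cover) public

  abstract
    shallow? : ∀ k → Decidable (Shallow k)
    shallow? k p = any? (λ N → _~?_ k (N , ψ) p) (models k)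

    peak? : ∀ k → Decidable (Peak k)
    peak? k p = any? (λ N → _~?_ k (N , α₁) p) (models k)

  module _ {k : ℕ} where

    abstract
      at-ψ : ∀ {M p} → (M , ψ) ~[ k ] p → Shallow k p
      at-ψ {M} M~p with models-complete k M
      ... | N , N∈ , same = lose N∈ (~-trans (~-sym (same⇒~ same ψ)) M~p)

      at-α₁ : ∀ {M p} → (M , α₁) ~[ k ] p → Peak k p
      at-α₁ {M} M~p with models-complete k M
      ... | N , N∈ , same = lose N∈ (~-trans (~-sym (same⇒~ same α₁)) M~p)

      max⇒shallow : ∀ {M w} → Maximal w → Shallow k (M , w)
      max⇒shallow {M} max = at-ψ (proj₁ (proj₂ (repaint-max ψ-fork k M max)))

      max⇒peak : ∀ {M w} → Maximal w → Peak k (M , w)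
      max⇒peak {M} max = at-α₁ (proj₁ (proj₂ (proj₂ (repaint-max ψ-fork k M max))))

      fork⇒shallow : ∀ {M w v₁ v₂} → Fork w v₁ v₂ → Shallow k (M , w)
      fork⇒shallow {M} F = at-ψ (proj₁ (proj₂ (repaint-fork ψ-fork k M F)))

      shallow-resp : ∀ {p q} → p ~[ k ] q → Shallow k p → Shallow k q
      shallow-resp p~q = Any.map (λ ~p → ~-trans ~p p~q)

      peak-resp : ∀ {p q} → p ~[ k ] q → Peak k p → Peak k q
      peak-resp p~q = Any.map (λ ~p → ~-trans ~p p~q)

      peak-up : ∀ {M w v} → Peak k (M , w) → w ≤ v → (M , w) ~[ k ] (M , v)
      peak-up pk w≤v with find pk
      ... | N , _ , N~p = ~-trans (~-sym N~p) (max~-up α₁-max N~p w≤v)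

      -- By `⊑⇒above~`, `q` is equivalent to `ψ` or to one of its prongs. Closure under `⊑` makes
      -- shallowness definable by a formula, hence usable as a colour.
      shallow-⊑ : ∀ {p q} → Shallow k p → p ⊑[ k ] q → Shallow k q
      shallow-⊑ sh p⊑q with find sh
      ... | N , N∈ , N~p with ⊑⇒above~ k (⊑-trans (~⇒⊑ N~p) p⊑q)
      ... | v , ψ≤v , v~q with ψ-cover v ψ≤v
      ... | inj₁ refl        = lose N∈ v~q
      ... | inj₂ (inj₁ refl) = shallow-resp v~q (max⇒shallow α₁-max)
      ... | inj₂ (inj₂ refl) = shallow-resp v~q (max⇒shallow α₂-max)

      maximal-of-ψ : ∀ {v} → ψ ≤ v → Maximal v → v ≡ α₁ ⊎ v ≡ α₂
      maximal-of-ψ {v} ψ≤v max with ψ-cover v ψ≤v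
      ... | inj₁ refl  = inj₁ (sym (max α₁ ψ≤α₁))
      ... | inj₂ v≡α   = v≡α

    -- The second argument of `root` is a collapsing principle: a root whose proper successors all
    -- look maximal looks like a fork. It is how `lift-shallow` recognises shallow preimages.
    data Rooted (M : Model) (w : W) : Set where
      shallow : Shallow k (M , w) → Rooted M w
      root    : (∀ v → w ≤ v → v ≡ w ⊎ Shallow k (M , v)) →
                ((∀ v → w ≤ v → v ≡ w ⊎ Peak k (M , v)) → Shallow k (M , w)) → Rooted M w

    abstract
      rooted : ∀ M w → Rooted M w
      rooted M w with kind w
      ... | maximal max = shallow (max⇒shallow max)
      ... | fork _ _ F  = shallow (fork⇒shallow F)
      ... | root₁ v s s₁ s₂ R = root
        (λ y w≤y → Sum.map₂ [ (λ { refl → max⇒shallow maxᵥ })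
                            , (λ s≤y → shallow-⊑ (fork⇒shallow F) (≤⇒⊑ s≤y)) ]′ (cover y w≤y))
        collapse
        where
        open Root₁ R renaming (fork to F)
        open Fork F using () renaming (max₁ to max-s₁; w≤v₁ to s≤s₁)
        collapse : (∀ y → w ≤ y → y ≡ w ⊎ Peak k (M , y)) → Shallow k (M , w)
        collapse peaks with peaks s w≤s
        ... | inj₁ refl = fork⇒shallow F
        -- The whole cone of `s` looks maximal, so `w` looks like a fork with prongs `v` and `s₁`.
        ... | inj₂ pks with repaint ψ-fork k M w≤v (≤-trans w≤s s≤s₁) maxᵥ max-s₁
        ... | N , atoms , ~₁ , ~₂ = at-ψ (~-step atoms
          (λ y ψ≤y → Sum.map₂ [ (λ { refl → v , w≤v , ~₁ })
                              , (λ { refl → s₁ , ≤-trans w≤s s≤s₁ , ~₂ }) ]′ (ψ-cover y ψ≤y))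
          (λ y w≤y → Sum.map₂ [ (λ { refl → α₁ , ψ≤α₁ , ~₁ })
                              , (λ s≤y → α₂ , ψ≤α₂ ,
                                   ~-trans ~₂ (~-trans (~-sym (peak-up pks s≤s₁)) (peak-up pks s≤y))) ]′
                              (cover y w≤y)))
      ... | root₂ v s m v₁ s₁ R = root
        (λ y w≤y → Sum.map₂ [ (λ v≤y → shallow-⊑ (fork⇒shallow forkᵥ) (≤⇒⊑ v≤y))
                            , (λ s≤y → shallow-⊑ (fork⇒shallow forkₛ) (≤⇒⊑ s≤y)) ]′ (cover y w≤y))
        collapse
        where
        open Root₂ R
        open Fork forkᵥ using () renaming (max₁ to max-m; w≤v₁ to v≤m)
        open Fork forkₛ using () renaming (w≤v₁ to s≤m)
        collapse : (∀ y → w ≤ y → y ≡ w ⊎ Peak k (M , y)) → Shallow k (M , w)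
        collapse peaks with peaks v w≤v | peaks s w≤s
        ... | inj₁ refl | _         = fork⇒shallow forkᵥ
        ... | inj₂ _    | inj₁ refl = fork⇒shallow forkₛ
        -- Both sides look like the shared point `m`, so `w` looks like a fork with both prongs
        -- coloured as `m`.
        ... | inj₂ pkv  | inj₂ pks with repaint ψ-fork k M (≤-trans w≤v v≤m) (≤-trans w≤v v≤m) max-m max-m
        ... | N , atoms , ~₁ , ~₂ = at-ψ (~-step atoms
          (λ y ψ≤y → Sum.map₂ [ (λ { refl → m , ≤-trans w≤v v≤m , ~₁ })
                              , (λ { refl → m , ≤-trans w≤v v≤m , ~₂ }) ]′ (ψ-cover y ψ≤y))
          (λ y w≤y → Sum.map₂ [ (λ v≤y → α₁ , ψ≤α₁ ,
                                   ~-trans ~₁ (~-trans (~-sym (peak-up pkv v≤m)) (peak-up pkv v≤y)))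
                              , (λ s≤y → α₁ , ψ≤α₁ ,
                                   ~-trans ~₁ (~-trans (~-sym (peak-up pks s≤m)) (peak-up pks s≤y))) ]′
                              (cover y w≤y)))

-- Colouring the models over `k` variables by means of `μ`.

module Factorisation (AF : AmalgamationFrame) (n k : ℕ) (μ : Subst) (μ-below : ∀ x → x < n → Below k (μ x)) where
  open AmalgamationFrame AF
  open Kripke finite
  open LocalFiniteness finite
  open ShapeLemmas AF

  m : ℕ
  m = arity n

  n<m : n < m
  n<m = n<arity n

  subst-point : Subst → Point → Point
  subst-point σ (M , w) = substModel σ M , w

  abstract
    subst-⊑ : ∀ σ {i j} → (∀ x → x < i → Below j (σ x)) → ∀ {p q} →
              p ⊑[ j ] q → subst-point σ p ⊑[ i ] subst-point σ q
    subst-⊑ σ bσ {M , w} {N , v} p⊑q = incl λ A bA ⊩A →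
      proj₁ (⊩-sub σ N v A) (transfer p⊑q (sub σ A) (sub-below σ bσ A bA) (proj₂ (⊩-sub σ M w A) ⊩A))

    subst-~ : ∀ σ {i j} → (∀ x → x < i → Below j (σ x)) → ∀ {p q} →
              p ~[ j ] q → subst-point σ p ~[ i ] subst-point σ q
    subst-~ σ {i} bσ p~q = ⊑-antisym i (subst-⊑ σ bσ (~⇒⊑ p~q)) (subst-⊑ σ bσ (~⇒⊒ p~q))

  f : Point → Point
  f = subst-point μ

  abstract
    f-~ : ∀ {p q} → p ~[ k ] q → f p ~[ n ] f q
    f-~ = subst-~ μ μ-below

  -- Between maximal points with the same prongs, a fork can be replaced by one with the same image under f.
  Prong : Point → Point → Set
  Prong x q = Any (λ N → (N , α₁) ~[ k ] q × f (N , ψ) ~[ n ] x) (models k)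

  abstract
    prong? : ∀ x → Decidable (Prong x)
    prong? x q = any? (λ N → _~?_ k (N , α₁) q ×-dec _~?_ n (f (N , ψ)) x) (models k)

  abstract
    prong-⊑ : ∀ {x p q} → p ⊑[ k ] q → Prong x p → Prong x q
    prong-⊑ p⊑q = Any.map λ (N~p , fN~x) → max-⊑⇒~ α₁-max (⊑-trans (~⇒⊑ N~p) p⊑q) , fN~x

    at-prong : ∀ {N x q} → (N , α₁) ~[ k ] q → f (N , ψ) ~[ n ] x → Prong x q
    at-prong {N} N~q fN~x with models-complete k N
    ... | N' , N'∈ , same = lose N'∈ (~-trans (~-sym (same⇒~ same α₁)) N~q
                                     , ~-trans (f-~ (~-sym (same⇒~ same ψ))) fN~x)

    prong⇒peak : ∀ {x q} → Prong x q → Peak k q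
    prong⇒peak = Any.map proj₁

  shallowFm : Fm
  shallowFm = Definable.formula k (shallow? k) (λ p⊑q sh → shallow-⊑ sh p⊑q)

  prongFm : Point → Fm
  prongFm x = Definable.formula k (prong? x) prong-⊑

  M₀ : Model
  M₀ = model (λ _ _ → false) (λ _ _ ())

  -- The variables below `n` carry `μ`, variable `n` shallowness, and the next ones the prongs, one
  -- for each enumerated point over `n` variables. From `m` on comes a full copy of `μ`: it recovers
  -- `μ x` for `x` from `n` on, where `ε` has the value `var (m + x)`.
  colourFm : ℕ → Fm
  colourFm y with y <? n | y ≟ n | y <? m
  ... | yes _ | _     | _     = μ y
  ... | no _  | yes _ | _     = shallowFm
  ... | no _  | no _  | yes _ = prongFm (nth (M₀ , ψ) (points n) (y ∸ suc n))
  ... | no _  | no _  | no _  = μ (y ∸ m)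

  colourFm-below : ∀ y → y < m → Below k (colourFm y)
  colourFm-below y y<m with y <? n | y ≟ n | y <? m
  ... | yes y<n | _     | _      = μ-below y y<n
  ... | no _    | yes _ | _      = Definable.formula-below k (shallow? k) (λ p⊑q sh → shallow-⊑ sh p⊑q)
  ... | no _    | no _  | yes _  = Definable.formula-below k (prong? _) prong-⊑
  ... | no _    | no _  | no y≮m = contradiction y<m y≮m

  colourFm-old : ∀ y → y < n → colourFm y ≡ μ y
  colourFm-old y y<n with y <? n
  ... | yes _  = refl
  ... | no y≮n = contradiction y<n y≮n

  colourFm-shallow : colourFm n ≡ shallowFm
  colourFm-shallow with n <? n | n ≟ n
  ... | yes n<n | _       = contradiction n<n (<-irrefl refl)
  ... | no _    | yes _   = refl
  ... | no _    | no n≢n  = contradiction refl n≢n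

  colourFm-prong : ∀ j → j < length (points n) → colourFm (suc n + j) ≡ prongFm (nth (M₀ , ψ) (points n) j)
  colourFm-prong j j< with suc n + j <? n | suc n + j ≟ n | suc n + j <? m
  ... | yes y<n | _       | _      = contradiction y<n (m+n≮m n (suc j) ∘ subst (_< n) (sym (+-suc n j)))
  ... | no _    | yes y≡n | _      = contradiction (m≤m+n (suc n) j) (<-irrefl (sym y≡n))
  ... | no _    | no _    | no y≮m = contradiction (index<arity n j j<) y≮m
  ... | no _    | no _    | yes _  = cong (λ i → prongFm (nth (M₀ , ψ) (points n) i)) (m+n∸m≡n (suc n) j)

  colourFm-rest : ∀ y → colourFm (m + y) ≡ μ y
  colourFm-rest y with m + y <? n | m + y ≟ n | m + y <? m
  ... | yes y<n | _       | _       = contradiction (<-≤-trans n<m (m≤m+n m y)) (<⇒≱ y<n ∘ <⇒≤)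
  ... | no _    | yes y≡n | _       = contradiction (<-≤-trans n<m (m≤m+n m y)) (<-irrefl (sym y≡n))
  ... | no _    | no _    | yes y<m = contradiction y<m (m+n≮m m y)
  ... | no _    | no _    | no _    = cong μ (m+n∸m≡n m y)

  h : Point → Point
  h = subst-point colourFm

  h-~ : ∀ {p q} → p ~[ k ] q → h p ~[ m ] h q
  h-~ = subst-~ colourFm colourFm-below

  abstract
    -- The first `n` colours of `h p` are those of `f p`, so `h` remembers `f`.
    h⊑⇒f⊑ : ∀ {p q} → h p ⊑[ m ] h q → f p ⊑[ n ] f q
    h⊑⇒f⊑ {M , w} {N , v} hp⊑hq = incl λ A bA ⊩A →
      proj₁ (h⇔f N v A bA) (transfer hp⊑hq A (Below-mono (<⇒≤ n<m) A bA) (proj₂ (h⇔f M w A bA) ⊩A))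
      where
      old : ∀ M w → (h (M , w)) ~[ n ] (f (M , w))
      old M w = same⇒~ (λ x x<n v →
        (λ ⊩x → proj₁ (⊩-sub μ M v (var x)) (subst ((M , v) ⊩_) (colourFm-old x x<n) (proj₂ (⊩-sub colourFm M v (var x)) ⊩x))) ,
        (λ ⊩x → proj₁ (⊩-sub colourFm M v (var x)) (subst ((M , v) ⊩_) (sym (colourFm-old x x<n)) (proj₂ (⊩-sub μ M v (var x)) ⊩x)))) w
      h⇔f : ∀ M w A → Below n A → (h (M , w) ⊩ A) iff (f (M , w) ⊩ A)
      h⇔f M w = agree (old M w)

    h~⇒f~ : ∀ {p q} → h p ~[ m ] h q → f p ~[ n ] f q
    h~⇒f~ hp~hq = ⊑-antisym n (h⊑⇒f⊑ (~⇒⊑ hp~hq)) (h⊑⇒f⊑ (~⇒⊒ hp~hq))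

    h-var : ∀ {y B} M w → colourFm y ≡ B → (h (M , w) ⊩ var y) iff ((M , w) ⊩ B)
    h-var {y} M w refl = proj₂ (⊩-sub colourFm M w (var y)) , proj₁ (⊩-sub colourFm M w (var y))

    h-⊑-shallow : ∀ {p q} → h p ⊑[ m ] h q → Shallow k p → Shallow k q
    h-⊑-shallow {M , w} {N , v} hp⊑hq sh =
      proj₁ (D.⊩formula (N , v)) (proj₁ (h-var N v colourFm-shallow)
        (transfer hp⊑hq (var n) n<m (proj₂ (h-var M w colourFm-shallow) (proj₂ (D.⊩formula (M , w)) sh))))
      where module D = Definable k (shallow? k) (λ p⊑q sh → shallow-⊑ sh p⊑q)

    -- Only the enumerated points over `n` variables own a colour variable, so `f (N₁ , ψ)` is
    -- exchanged for an equivalent `X` and back.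
    h-⊑-prong : ∀ {N₁ p q} → h p ⊑[ m ] h q → Prong (f (N₁ , ψ)) p → Prong (f (N₁ , ψ)) q
    h-⊑-prong {N₁} {M , w} {N , v} hp⊑hq pr with points-complete n (proj₁ (f (N₁ , ψ))) ψ
    ... | X , X∈ , fN₁~X with ∈⇒nth {z = M₀ , ψ} X∈
    ... | j , j< , nth≡ = Any.map (λ (~q , ~X) → ~q , ~-trans ~X (~-sym fN₁~X))
      (proj₁ (D.⊩formula (N , v)) (proj₁ (h-var N v colour≡)
        (transfer hp⊑hq (var (suc n + j)) (index<arity n j j<) (proj₂ (h-var M w colour≡)
          (proj₂ (D.⊩formula (M , w)) (Any.map (λ (~p , ~N₁) → ~p , ~-trans ~N₁ fN₁~X) pr))))))
      where
      module D = Definable k (prong? (X , ψ)) prong-⊑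
      colour≡ : colourFm (suc n + j) ≡ D.formula
      colour≡ = trans (colourFm-prong j j<) (cong prongFm nth≡)

  -- Lifting peaks and forks through `h`.

  InImage : Point → Set
  InImage p = Any (λ q → h q ~[ m ] p) (points k)

  abstract
    inImage? : Decidable InImage
    inImage? p = any? (λ q → _~?_ m (h q) p) (points k)

    in-image : ∀ {q p} → h q ~[ m ] p → InImage p
    in-image {M , w} hq~p with points-complete k M w
    ... | N , ∈pts , q~ = lose ∈pts (~-trans (~-sym (h-~ q~)) hq~p)

    -- `h` keeps worlds and their order, so a point above `h q` is the image of one above `q`;
    -- `⊑⇒above~` reduces `⊑` to this case.
    inImage-⊑ : ∀ {p p'} → p ⊑[ m ] p' → InImage p → InImage p'
    inImage-⊑ p⊑p' im with find im
    ... | q , _ , hq~p with ⊑⇒above~ m (⊑-trans (~⇒⊑ hq~p) p⊑p')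
    ... | v , _ , hv~p' = in-image hv~p'

    -- Moving from a preimage to a maximal point above it does not change the image up to
    -- equivalence, because the image looks maximal.
    lift-peak : ∀ {p} → InImage p → Peak m p → Any (λ N → h (N , α₁) ~[ m ] p) (models k)
    lift-peak im pk with find im | find pk
    ... | (M , w) , _ , hq~p | N₀ , _ , N₀~p with top w
    ... | v , w≤v , max with find (max⇒peak {k} {M} max)
    ... | N , N∈ , N~v = lose N∈ (~-trans (h-~ N~v)
      (~-trans (~-sym (max~-up α₁-max (~-trans N₀~p (~-sym hq~p)) w≤v)) N₀~p))

    -- A preimage `q` that is not shallow is a root with shallow proper successors, whose images lie
    -- at or above `ψ`. The shallowness colour excludes `ψ`, so these images are maximal; the prong
    -- colours then force the successors to be peaks, and `q` collapses.
    lift-shallow : ∀ {N₀} → InImage (N₀ , ψ) → Any (λ N → h (N , ψ) ~[ m ] (N₀ , ψ)) (models k)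
    lift-shallow {N₀} im with find im
    ... | q@(M , w) , _ , hq~ = Any.map (λ N~q → ~-trans (h-~ N~q) hq~) q-shallow
      where
      q-shallow : Shallow k q
      q-shallow with rooted {k} M w | shallow? k q
      ... | shallow sh    | _      = sh
      ... | _             | yes sh = sh
      ... | root all join | no ¬sh = join λ v w≤v → Sum.map₂ (peak v w≤v) (all v w≤v)
        where
        peak : ∀ v → w ≤ v → Shallow k (M , v) → Peak k (M , v)
        peak v w≤v v-shallow with ⊑⇒above~ m (⊑-trans (~⇒⊒ hq~) (≤⇒⊑ w≤v))
        ... | y , ψ≤y , y~hv with ψ-cover y ψ≤y
        ... | inj₁ refl = contradiction (h-⊑-shallow (~⇒⊑ (~-trans (~-sym y~hv) (~-sym hq~))) v-shallow) ¬sh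
        ... | inj₂ y≡α with top v
        ...   | v' , v≤v' , max with repaint-max ψ-fork k M max
        -- The constant fork over `v'` gives `v'` a prong; `v` has the same colours, so it has this
        -- prong too and is a peak.
        ...   | N , Nψ~ , N₁~ , _ = prong⇒peak (h-⊑-prong {N} (~⇒⊑ (~-trans (~-sym (max~-up y-max y~hv v≤v')) y~hv))
                                                 (at-prong {N} N₁~ ~-refl))
          where
          y-max : Maximal y
          y-max = [ (λ { refl → α₁-max }) , (λ { refl → α₂-max }) ]′ y≡α

  abstract
    -- The default `M₀` serves outside the image: any maximal point is an admissible lift of a peak
    -- without preimage.
    peakLift : Point → Model
    peakLift p = pick (λ N → _~?_ m (h (N , α₁)) p) M₀ (models k)

    peakLift-cong : ∀ {p p'} → p ~[ m ] p' → peakLift p ≡ peakLift p'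
    peakLift-cong {p} {p'} p~p' = pick-cong (λ N → _~?_ m (h (N , α₁)) p) (λ N → _~?_ m (h (N , α₁)) p')
      (λ N → (λ ~p → ~-trans ~p p~p') , (λ ~p' → ~-trans ~p' (~-sym p~p'))) (models k) refl

    peakLift-lifts : ∀ {p} → InImage p → Peak m p → h (peakLift p , α₁) ~[ m ] p
    peakLift-lifts {p} im pk = pick-any (λ N → _~?_ m (h (N , α₁)) p) (models k) (lift-peak im pk)

  abstract
    join-paint : ∀ N₁ N₂ → ∃ λ M → M ∙ ψ ≐ ((λ _ → true) ⊓ (colour N₁ α₁ ⊓ colour N₂ α₁))
                                 × M ∙ α₁ ≐ colour N₁ α₁ × M ∙ α₂ ≐ colour N₂ α₁
    join-paint N₁ N₂ = Fork.paint ψ-fork (λ _ → true) (colour N₁ α₁) (colour N₂ α₁)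

    join : Model → Model → Model
    join N₁ N₂ = proj₁ (join-paint N₁ N₂)

    join~₁ : ∀ N₁ N₂ → (join N₁ N₂ , α₁) ~[ k ] (N₁ , α₁)
    join~₁ N₁ N₂ = max~ α₁-max α₁-max (λ x _ → iff-≡ (proj₁ (proj₂ (proj₂ (join-paint N₁ N₂))) x))

    join~₂ : ∀ N₁ N₂ → (join N₁ N₂ , α₂) ~[ k ] (N₂ , α₁)
    join~₂ N₁ N₂ = max~ α₂-max α₁-max (λ x _ → iff-≡ (proj₂ (proj₂ (proj₂ (join-paint N₁ N₂))) x))

  abstract
    -- A fork with a preimage is lifted to one, as the factorisation of `μ` demands; any other fork
    -- is lifted by joining the lifts of its prongs.
    forkLift : Model → Model
    forkLift N₀ = pick (λ N → _~?_ m (h (N , ψ)) (N₀ , ψ))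
                       (join (peakLift (N₀ , α₁)) (peakLift (N₀ , α₂))) (models k)

    forkLift-lifts : ∀ {N₀} → InImage (N₀ , ψ) → h (forkLift N₀ , ψ) ~[ m ] (N₀ , ψ)
    forkLift-lifts {N₀} im = pick-any (λ N → _~?_ m (h (N , ψ)) (N₀ , ψ)) (models k) (lift-shallow im)

    forkLift-join : ∀ {N₀} → ¬ InImage (N₀ , ψ) → forkLift N₀ ≡ join (peakLift (N₀ , α₁)) (peakLift (N₀ , α₂))
    forkLift-join {N₀} ¬im = pick-none (λ N → _~?_ m (h (N , ψ)) (N₀ , ψ)) (models k)
      (λ any → let (N , _ , hN~) = find any in ¬im (in-image hN~))

  abstract
    -- `Prong` speaks only of forks seen from `α₁`; exchanging the prongs brings `α₂` there.
    swap-prongs : ∀ N → ∃ λ N' → (N' , ψ) ~[ k ] (N , ψ) × (N' , α₁) ~[ k ] (N , α₂)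
    swap-prongs N with repaint-fork ψ-fork k N (Fork-swap ψ-fork)
    ... | N' , ~ψ , ~₁ , _ = N' , ~ψ , ~₁

    -- The lift of a fork and the separately chosen lift of its prong need not fit together, but
    -- some fork with the same image under `f` sits below the latter. For a `join` this holds by
    -- construction; for a preimage, one of its maximal points has the same colours as the chosen
    -- lift, and the prong colours transfer the fork.
    forkLift-prong : ∀ N₀ {v} → v ≡ α₁ ⊎ v ≡ α₂ → ∃ λ N →
                     (N , α₁) ~[ k ] (peakLift (N₀ , v) , α₁) × f (N , ψ) ~[ n ] f (forkLift N₀ , ψ)
    forkLift-prong N₀ {v} v≡α with inImage? (N₀ , ψ)
    forkLift-prong N₀ (inj₁ refl) | no ¬im = _ , join~₁ (peakLift (N₀ , α₁)) (peakLift (N₀ , α₂)) , ~-reflexive (cong (λ N → f (N , ψ)) (sym (forkLift-join ¬im)))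
    forkLift-prong N₀ (inj₂ refl) | no ¬im with swap-prongs (join (peakLift (N₀ , α₁)) (peakLift (N₀ , α₂)))
    ... | N , ~ψ , ~₁ = N , ~-trans ~₁ (join~₂ (peakLift (N₀ , α₁)) (peakLift (N₀ , α₂)))
                      , ~-trans (f-~ ~ψ) (~-reflexive (cong (λ N → f (N , ψ)) (sym (forkLift-join ¬im))))
    forkLift-prong N₀ {v} v≡α | yes im = result
      where
      s : Model
      s = forkLift N₀
      v-max : Maximal v
      v-max = [ (λ { refl → α₁-max }) , (λ { refl → α₂-max }) ]′ v≡α
      ψ≤v : ψ ≤ v
      ψ≤v = [ (λ { refl → ψ≤α₁ }) , (λ { refl → ψ≤α₂ }) ]′ v≡α
      prong-at : ∀ {t'} → t' ≡ α₁ ⊎ t' ≡ α₂ → Prong (f (s , ψ)) (s , t')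
      prong-at (inj₁ refl) = at-prong {s} ~-refl ~-refl
      prong-at (inj₂ refl) with swap-prongs s
      ... | N , ~ψ , ~₁ = at-prong {N} ~₁ (f-~ ~ψ)
      prong-v : Prong (f (s , ψ)) (peakLift (N₀ , v) , α₁)
      prong-v with ⊑⇒above~ m (⊑-trans (~⇒⊑ (forkLift-lifts im)) (≤⇒⊑ ψ≤v))
      ... | y , ψ≤y , hy~v with top y
      ... | y' , y≤y' , max =
        -- Both `(s , y')` and the chosen lift have image `(N₀ , v)` under `h`, hence the same
        -- prongs.
        h-⊑-prong {s} (~⇒⊑ (~-trans (~-sym (max~-up v-max (~-sym hy~v) y≤y'))
                                   (~-sym (peakLift-lifts (in-image hy~v) (max⇒peak v-max)))))
                  (prong-at (maximal-of-ψ {k} (≤-trans ψ≤y y≤y') max))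
      result : ∃ λ N → (N , α₁) ~[ k ] (peakLift (N₀ , v) , α₁) × f (N , ψ) ~[ n ] f (s , ψ)
      result = let (N , _ , ~₁ , ~s) = find prong-v in N , ~₁ , ~s

  abstract
    forkRep : Point → Model
    forkRep p = pick (λ N → _~?_ m (N , ψ) p) M₀ (models m)

    forkRep-cong : ∀ {p p'} → p ~[ m ] p' → forkRep p ≡ forkRep p'
    forkRep-cong {p} {p'} p~p' = pick-cong (λ N → _~?_ m (N , ψ) p) (λ N → _~?_ m (N , ψ) p')
      (λ N → (λ ~p → ~-trans ~p p~p') , (λ ~p' → ~-trans ~p' (~-sym p~p'))) (models m) refl

    forkRep~ : ∀ {p} → Shallow m p → (forkRep p , ψ) ~[ m ] p
    forkRep~ {p} sh = pick-any (λ N → _~?_ m (N , ψ) p) (models m) sh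

  shallowLift′ : ∀ p → Dec (Peak m p) → Point
  shallowLift′ p (yes _) = peakLift p , α₁
  shallowLift′ p (no _)  = forkLift (forkRep p) , ψ

  abstract
    shallowLift : Point → Point
    shallowLift p = shallowLift′ p (peak? m p)

    shallowLift-peak : ∀ {p} → Peak m p → shallowLift p ≡ (peakLift p , α₁)
    shallowLift-peak {p} pk with peak? m p
    ... | yes _  = refl
    ... | no ¬pk = contradiction pk ¬pk

    shallowLift-fork : ∀ {p} → ¬ Peak m p → shallowLift p ≡ (forkLift (forkRep p) , ψ)
    shallowLift-fork {p} ¬pk with peak? m p
    ... | yes pk = contradiction pk ¬pk
    ... | no _   = refl

    shallowLift-cong : ∀ {p p'} → p ~[ m ] p' → shallowLift p ≡ shallowLift p'
    shallowLift-cong {p} {p'} p~p' with peak? m p | peak? m p'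
    ... | yes _  | yes _   = cong (_, α₁) (peakLift-cong p~p')
    ... | no _   | no _    = cong (λ N → forkLift N , ψ) (forkRep-cong p~p')
    ... | yes pk | no ¬pk  = contradiction (peak-resp p~p' pk) ¬pk
    ... | no ¬pk | yes pk  = contradiction (peak-resp (~-sym p~p') pk) ¬pk

    -- This carries `forkLift-prong` to any fork of the frame through its representative at `ψ`. A
    -- fork that looks maximal is lifted as a peak, and the constant fork over that peak serves.
    shallowLift-prong : ∀ M {w v₁ v₂} → Fork w v₁ v₂ → ∃ λ N →
                        (N , α₁) ~[ k ] (peakLift (M , v₁) , α₁) × f (N , ψ) ~[ n ] f (shallowLift (M , w))
    shallowLift-prong M {w} {v₁} {v₂} F with peak? m (M , w)
    ... | yes pk with repaint-max ψ-fork k (peakLift (M , w)) α₁-max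
    ...   | N , ~ψ , ~₁ , _ = N , ~-trans ~₁ (~-reflexive (cong (_, α₁) (peakLift-cong (peak-up pk (Fork.w≤v₁ F)))))
                            , f-~ ~ψ
    shallowLift-prong M {w} {v₁} {v₂} F | no _
      with ⊑⇒above~ m (⊑-trans (~⇒⊑ (forkRep~ (fork⇒shallow {m} {M} F))) (≤⇒⊑ (Fork.w≤v₁ F)))
    ... | y , ψ≤y , y~v₁ with top y
    ... | y' , y≤y' , max with forkLift-prong (forkRep (M , w)) (maximal-of-ψ {m} (≤-trans ψ≤y y≤y') max)
    ... | N , ~₁ , ~s = N , ~-trans ~₁ (~-reflexive (cong (_, α₁)
                            (peakLift-cong (~-sym (max~-up (Fork.max₁ F) (~-sym y~v₁) y≤y'))))) , ~s

  -- Amalgamation at a root, and the lift of an arbitrary point.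

  Amalgam : Model → W → Model → Set
  Amalgam M w N = ∀ y → w ≤ y → y ≡ w ⊎ ∃ λ z → w ≤ z × z ≤ y × Shallow m (M , z)
                                              × f (N , z) ~[ n ] f (shallowLift (M , z))

  abstract
    -- The cone of `w` is repainted so that each side of the root has the same image under `f` as
    -- its lift. For `Root₁` the sides are disjoint; for `Root₂` they meet in one point, where
    -- `shallowLift-prong` makes both replacements agree with the same peak lift.
    amalgam : ∀ M w → Shallow m (M , w) ⊎ ∃ (Amalgam M w)
    amalgam M w with kind w
    ... | maximal max = inj₁ (max⇒shallow max)
    ... | fork _ _ F  = inj₁ (fork⇒shallow F)
    ... | root₁ v s s₁ s₂ R with shallowLift-prong M (Root₁.fork R)
    ...   | N₁ , _ , fN₁~ with Root₁.paint R (colour (peakLift (M , v)) α₁) (colour N₁ ψ) (colour N₁ α₁) (colour N₁ α₂)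
    ...   | N , N≐v , N≐s , N≐s₁ , N≐s₂ = inj₂ (N , λ y w≤y → Sum.map₂
              [ (λ { refl → v , w≤v , ≤-refl , max⇒shallow maxᵥ
                          , ~-trans (f-~ (max~ maxᵥ α₁-max (λ x _ → iff-≡ (N≐v x))))
                                    (~-reflexive (cong f (sym (shallowLift-peak (max⇒peak maxᵥ))))) })
              , (λ s≤y → s , w≤s , s≤y , fork⇒shallow F , ~-trans (f-~ s~) fN₁~) ]′ (cover y w≤y))
      where
      open Root₁ R renaming (fork to F)
      s~ : (N , s) ~[ k ] (N₁ , ψ)
      s~ = fork~ F ψ-fork (≐⇒atom {N} {s} {N = N₁} N≐s (λ x _ → ⊓-absorb N₁ ψ≤α₁ ψ≤α₂ x))
             (max~ (Fork.max₁ F) α₁-max (λ x _ → iff-≡ (N≐s₁ x)))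
             (max~ (Fork.max₂ F) α₂-max (λ x _ → iff-≡ (N≐s₂ x)))
    amalgam M w | root₂ v s t' v₁ s₁ R with shallowLift-prong M (Root₂.forkᵥ R) | shallowLift-prong M (Root₂.forkₛ R)
    ... | N₁ , N₁~ , fN₁~ | N₂ , N₂~ , fN₂~
      with Root₂.paint R (colour N₁ ψ) (colour N₂ ψ) (colour N₁ α₁) (colour N₁ α₂) (colour N₂ α₂)
    ... | N , N≐v , N≐s , N≐t , N≐v₁ , N≐s₁ = inj₂ (N , λ y w≤y → Sum.map₂
              [ (λ v≤y → v , w≤v , v≤y , fork⇒shallow forkᵥ , ~-trans (f-~ v~) fN₁~)
              , (λ s≤y → s , w≤s , s≤y , fork⇒shallow forkₛ , ~-trans (f-~ s~) fN₂~) ]′ (cover y w≤y))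
      where
      open Root₂ R
      t~ : (N , t') ~[ k ] (N₁ , α₁)
      t~ = max~ (Fork.max₁ forkᵥ) α₁-max (λ x _ → iff-≡ (N≐t x))
      v~ : (N , v) ~[ k ] (N₁ , ψ)
      v~ = fork~ forkᵥ ψ-fork (≐⇒atom {N} {v} {N = N₁} N≐v (λ x _ → ⊓-absorb N₁ ψ≤α₁ ψ≤α₂ x)) t~
             (max~ (Fork.max₂ forkᵥ) α₂-max (λ x _ → iff-≡ (N≐v₁ x)))
      N₁~N₂ : (N₁ , α₁) ~[ k ] (N₂ , α₁)
      N₁~N₂ = ~-trans N₁~ (~-sym N₂~)
      -- The shared point is painted from `N₁`, so absorbing its colour into that of `N₂` at `ψ`
      -- goes through `N₁~N₂`.
      s-atoms : ∀ x → x < k → T ((colour N₂ ψ ⊓ (colour N₁ α₁ ⊓ colour N₂ α₂)) x) iff T (val N₂ x ψ)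
      s-atoms x x<k =
        (λ p → proj₁ (Equivalence.to T-∧ p)) ,
        (λ p → Equivalence.from T-∧ (p , Equivalence.from T-∧
          (proj₂ (agree N₁~N₂ (var x) x<k) (mono N₂ x ψ≤α₁ p) , mono N₂ x ψ≤α₂ p)))
      s~ : (N , s) ~[ k ] (N₂ , ψ)
      s~ = fork~ forkₛ ψ-fork (≐⇒atom {N} {s} {N = N₂} N≐s s-atoms) (~-trans t~ N₁~N₂)
             (max~ (Fork.max₂ forkₛ) α₂-max (λ x _ → iff-≡ (N≐s₁ x)))

  abstract
    pointRep : Point → Point
    pointRep p = pick (λ q → _~?_ m q p) (M₀ , ψ) (points m)

    pointRep-cong : ∀ {p p'} → p ~[ m ] p' → pointRep p ≡ pointRep p'
    pointRep-cong {p} {p'} p~p' = pick-cong (λ q → _~?_ m q p) (λ q → _~?_ m q p')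
      (λ N → (λ ~p → ~-trans ~p p~p') , (λ ~p' → ~-trans ~p' (~-sym p~p'))) (points m) refl

    pointRep~ : ∀ p → pointRep p ~[ m ] p
    pointRep~ p@(M , w) with points-complete m M w
    ... | N , ∈pts , p~ = pick-any (λ q → _~?_ m q p) (points m) (lose ∈pts (~-sym p~))

  amalgamPoint : ∀ p → Shallow m p ⊎ ∃ (Amalgam (proj₁ p) (proj₂ p)) → Point
  amalgamPoint p       (inj₁ _)       = p
  amalgamPoint (_ , w) (inj₂ (N , _)) = N , w

  rootLift : Point → Point
  rootLift p@(M , w) = pick (λ q → _~?_ m (h q) p) (amalgamPoint p (amalgam M w)) (points k)

  lift′ : ∀ p → Dec (Shallow m p) → Point
  lift′ p (yes _) = shallowLift p
  lift′ p (no _)  = rootLift (pointRep p)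

  abstract
    lift : Point → Point
    lift p = lift′ p (shallow? m p)

    lift-shallow≡ : ∀ {p} → Shallow m p → lift p ≡ shallowLift p
    lift-shallow≡ {p} sh with shallow? m p
    ... | yes _  = refl
    ... | no ¬sh = contradiction sh ¬sh

    lift-root≡ : ∀ {p} → ¬ Shallow m p → lift p ≡ rootLift (pointRep p)
    lift-root≡ {p} ¬sh with shallow? m p
    ... | yes sh = contradiction sh ¬sh
    ... | no _   = refl

    lift-cong : ∀ {p p'} → p ~[ m ] p' → lift p ≡ lift p'
    lift-cong {p} {p'} p~p' with shallow? m p | shallow? m p'
    ... | yes _  | yes _   = shallowLift-cong p~p'
    ... | no _   | no _    = cong rootLift (pointRep-cong p~p')
    ... | yes sh | no ¬sh  = contradiction (shallow-resp p~p' sh) ¬sh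
    ... | no ¬sh | yes sh  = contradiction (shallow-resp (~-sym p~p') sh) ¬sh

    lift-lifts : ∀ p → InImage p → h (lift p) ~[ m ] p
    lift-lifts p im with shallow? m p
    ... | no _ = ~-trans (pick-any (λ q → _~?_ m (h q) (pointRep p)) (points k)
                           (inImage-⊑ (~⇒⊒ (pointRep~ p)) im)) (pointRep~ p)
    ... | yes sh with peak? m p
    ...   | yes pk = peakLift-lifts im pk
    ...   | no _   = ~-trans (forkLift-lifts (inImage-⊑ (~⇒⊒ (forkRep~ sh)) im)) (forkRep~ sh)

  -- This is `f ∘ lift` as a p-morphism at `p`, up to equivalence. `forth` uses `⊑`, since the lifts
  -- of points of one model may live in different models.
  record Morphic (p : Point) : Set where
    constructor morphism
    field
      forth : ∀ v → proj₂ p ≤ v → f (lift p) ⊑[ n ] f (lift (proj₁ p , v))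
      back  : ∀ u → proj₂ (lift p) ≤ u →
              ∃ λ v → proj₂ p ≤ v × f (lift (proj₁ p , v)) ~[ n ] f (proj₁ (lift p) , u)
  open Morphic

  abstract
    morphic-resp : ∀ {p p'} → p ~[ m ] p' → Morphic p → Morphic p'
    morphic-resp {M , w} {M' , w'} p~p' mp = morphism
      (λ v' w'≤v' → let (v , w≤v , v~v') = ⊑⇒above~ m (⊑-trans (~⇒⊑ p~p') (≤⇒⊑ w'≤v')) in
         subst (λ q → f q ⊑[ n ] f (lift (M' , v'))) (lift-cong p~p')
           (⊑-trans (forth mp v w≤v) (~⇒⊑ (~-reflexive (cong f (lift-cong v~v'))))))
      (subst (λ q → ∀ u → proj₂ q ≤ u → ∃ λ v → w' ≤ v × f (lift (M' , v)) ~[ n ] f (proj₁ q , u)) (lift-cong p~p')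
        (λ u u≥ → let (v , w≤v , v~) = back mp u u≥
                      (v' , w'≤v' , v'~v) = ⊑⇒above~ m (⊑-trans (~⇒⊒ p~p') (≤⇒⊑ w≤v)) in
           v' , w'≤v' , ~-trans (~-reflexive (cong f (lift-cong v'~v))) v~))

    -- On the image `h ∘ lift` is the identity up to equivalence, and `h` determines `f`.
    morphic-lifts : ∀ p → InImage p → Morphic p
    morphic-lifts p@(M , w) im = morphism
      (λ v w≤v → h⊑⇒f⊑ (⊑-trans (~⇒⊑ (lift-lifts p im)) (⊑-trans (≤⇒⊑ w≤v)
                   (~⇒⊒ (lift-lifts (M , v) (inImage-⊑ (≤⇒⊑ w≤v) im))))))
      (λ u u≥ → let (v , w≤v , v~hu) = ⊑⇒above~ m (⊑-trans (~⇒⊒ (lift-lifts p im)) (≤⇒⊑ u≥)) in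
         v , w≤v , h~⇒f~ (~-trans (lift-lifts (M , v) (in-image (~-sym v~hu))) v~hu))

    -- If every proper successor passes through a `z` whose image under `f` is that of its lift, the
    -- conditions at `w` are inherited from those at `z`.
    morphic-cover : ∀ {M w N} → lift (M , w) ≡ (N , w) →
                    (∀ y → w ≤ y → y ≡ w ⊎ ∃ λ z → w ≤ z × z ≤ y × Morphic (M , z)
                                                × f (N , z) ~[ n ] f (lift (M , z))) →
                    Morphic (M , w)
    morphic-cover {M} {w} {N} eq cover = morphism forth′
      (subst (λ q → ∀ u → proj₂ q ≤ u → ∃ λ v → w ≤ v × f (lift (M , v)) ~[ n ] f (proj₁ q , u)) (sym eq) back′)
      where
      lift~ : f (lift (M , w)) ~[ n ] f (N , w)
      lift~ = ~-reflexive (cong f eq)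
      forth′ : ∀ v → w ≤ v → f (lift (M , w)) ⊑[ n ] f (lift (M , v))
      forth′ v w≤v with cover v w≤v
      ... | inj₁ refl = ~⇒⊑ ~-refl
      ... | inj₂ (z , w≤z , z≤v , mz , Nz~) =
        ⊑-trans (~⇒⊑ lift~) (⊑-trans (≤⇒⊑ w≤z) (⊑-trans (~⇒⊑ Nz~) (forth mz v z≤v)))
      back′ : ∀ u → w ≤ u → ∃ λ v → w ≤ v × f (lift (M , v)) ~[ n ] f (N , u)
      back′ u w≤u with cover u w≤u
      ... | inj₁ refl = w , ≤-refl , lift~
      ... | inj₂ (z , w≤z , z≤u , mz , Nz~) =
        let (u' , u'≥ , u'~u) = ⊑⇒above~ n (⊑-trans (~⇒⊒ Nz~) (≤⇒⊑ z≤u))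
            (v , z≤v , v~u') = back mz u' u'≥ in
        v , ≤-trans w≤z z≤v , ~-trans v~u' u'~u

    morphic-peak : ∀ {p} → Peak m p → Morphic p
    morphic-peak {p} pk with find pk
    ... | N , _ , N~p = morphic-resp N~p (morphic-cover
          (trans (lift-shallow≡ (max⇒shallow α₁-max)) (shallowLift-peak (max⇒peak α₁-max)))
          (λ y α₁≤y → inj₁ (α₁-max y α₁≤y)))

    morphic-shallow : ∀ {p} → Shallow m p → Morphic p
    morphic-shallow {p} sh with peak? m p | inImage? p
    ... | yes pk | _      = morphic-peak pk
    ... | no _   | yes im = morphic-lifts p im
    ... | no ¬pk | no ¬im = morphic-resp N₀~p (morphic-cover lift≡
          (λ y ψ≤y → Sum.map₂
            [ (λ { refl → α₁ , ψ≤α₁ , ≤-refl , morphic-peak (max⇒peak α₁-max) , prong~ α₁-max (join~₁ (peakLift (N₀ , α₁)) (peakLift (N₀ , α₂))) })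
            , (λ { refl → α₂ , ψ≤α₂ , ≤-refl , morphic-peak (max⇒peak α₂-max) , prong~ α₂-max (join~₂ (peakLift (N₀ , α₁)) (peakLift (N₀ , α₂))) }) ]′
            (ψ-cover y ψ≤y)))
      where
      N₀ : Model
      N₀ = forkRep p
      N₀~p : (N₀ , ψ) ~[ m ] p
      N₀~p = forkRep~ sh
      N : Model
      N = join (peakLift (N₀ , α₁)) (peakLift (N₀ , α₂))
      lift≡ : lift (N₀ , ψ) ≡ (N , ψ)
      lift≡ = trans (lift-shallow≡ (shallow-resp (~-sym N₀~p) sh))
             (trans (shallowLift-fork (λ pk → ¬pk (peak-resp N₀~p pk)))
               (cong (_, ψ) (trans (cong forkLift (forkRep-cong N₀~p))
                                   (forkLift-join (λ im → ¬im (inImage-⊑ (~⇒⊑ N₀~p) im))))))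
      prong~ : ∀ {v} → Maximal v → (N , v) ~[ k ] (peakLift (N₀ , v) , α₁) → f (N , v) ~[ n ] f (lift (N₀ , v))
      prong~ max N~ = ~-trans (f-~ N~) (~-reflexive (cong f (sym
                        (trans (lift-shallow≡ (max⇒shallow max)) (shallowLift-peak (max⇒peak max))))))

    -- The proof goes by increasing depth: peaks, then shallow points over peaks, then roots over
    -- shallow points. At the last two stages `morphic-lifts` settles the points of the image.
    morphic : ∀ p → Morphic p
    morphic p with shallow? m p | inImage? p
    ... | yes sh | _      = morphic-shallow sh
    ... | no _   | yes im = morphic-lifts p im
    ... | no ¬sh | no ¬im with amalgam (proj₁ (pointRep p)) (proj₂ (pointRep p)) in eq
    ...   | inj₁ sh = contradiction (shallow-resp (pointRep~ p) sh) ¬sh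
    ...   | inj₂ (N , N-amalgam) = morphic-resp (pointRep~ p) (morphic-cover lift≡
            (λ y ≤y → Sum.map₂ (λ (z , ≤z , z≤y , z-sh , Nz~) → z , ≤z , z≤y , morphic-shallow z-sh ,
                                   ~-trans Nz~ (~-reflexive (cong f (sym (lift-shallow≡ z-sh))))) (N-amalgam y ≤y)))
      where
      p₀ : Point
      p₀ = pointRep p
      lift≡ : lift p₀ ≡ (N , proj₂ p₀)
      lift≡ = trans (lift-root≡ (λ sh → ¬sh (shallow-resp (pointRep~ p) sh)))
             (trans (cong rootLift (pointRep-cong (pointRep~ p)))
             (trans (pick-none (λ q → _~?_ m (h q) p₀) (points k)
                      (λ any → ¬im (inImage-⊑ (~⇒⊑ (pointRep~ p)) any)))
                    (cong (amalgamPoint p₀) eq)))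

  -- The substitution defined by the lift.

  ValueAt : ℕ → Point → Set
  ValueAt x p = f (lift p) ⊩ var x

  valueAt? : ∀ x → Decidable (ValueAt x)
  valueAt? x p = f (lift p) ⊩? var x

  lift-⊑ : ∀ {p p'} → p ⊑[ m ] p' → f (lift p) ⊑[ n ] f (lift p')
  lift-⊑ {p} p⊑p' with ⊑⇒above~ m p⊑p'
  ... | v , w≤v , v~p' = ⊑-trans (forth (morphic p) v w≤v) (~⇒⊑ (~-reflexive (cong f (lift-cong v~p'))))

  module _ (x : ℕ) (x<n : x < n) where
    open Definable m (valueAt? x) (λ p⊑p' → transfer (lift-⊑ p⊑p') (var x) x<n) public
      using () renaming (formula to factorFm; formula-below to factorFm-below; ⊩formula to ⊩factorFm)

  -- `ε` is fixed only up to equivalence, so that its values can be drawn from the finite list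
  -- `formulas m`, which does not depend on `μ`.
  module _ (ε : Subst) (ε≃ : ∀ x (x<n : x < n) → ε x ≃ factorFm x x<n) where

    ε~lift : ∀ M w → (substModel ε M , w) ~[ n ] f (lift (M , w))
    ε~lift M w = Bisimulation.bisimilar⇒~ lift-bisimulation (M , w , refl , ~-refl)
      where
      lift-bisimulation : Bisimulation n λ p q → ∃ λ M → ∃ λ w → p ≡ (substModel ε M , w) × f (lift (M , w)) ~[ n ] q
      lift-bisimulation = record
        { atoms = λ { (M , w , refl , ~q) x x<n →
            (λ ⊩x → proj₁ (agree ~q (var x) x<n) (proj₁ (⊩factorFm x x<n (M , w))
                      (proj₁ (ε≃ x x<n (M , w)) (proj₂ (⊩-sub ε M w (var x)) ⊩x)))) ,
            (λ ⊩x → proj₁ (⊩-sub ε M w (var x)) (proj₂ (ε≃ x x<n (M , w))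
                      (proj₂ (⊩factorFm x x<n (M , w)) (proj₂ (agree ~q (var x) x<n) ⊩x)))) }
        ; forth = λ { (M , w , refl , ~q) w' w≤w' →
            let (v' , v≤v' , v'~) = ⊑⇒above~ n (⊑-trans (~⇒⊒ ~q) (forth (morphic (M , w)) w' w≤w')) in
            v' , v≤v' , M , w' , refl , ~-sym v'~ }
        ; back = λ { (M , w , refl , ~q) v' v≤v' →
            let (u , u≥ , u~v') = ⊑⇒above~ n (⊑-trans (~⇒⊑ ~q) (≤⇒⊑ v≤v'))
                (w' , w≤w' , w'~u) = back (morphic (M , w)) u u≥ in
            w' , w≤w' , M , w' , refl , ~-trans w'~u u~v' } }

    -- Pulling a model back along `ε` gives, up to equivalence, points in the image of `f`, where
    -- `A` holds because `μ` unifies it.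
    ε-unifies : ∀ A → Below n A → LogicOf frame (sub μ A) → LogicOf frame (sub ε A)
    ε-unifies A bA ⊨μA V V↑ w = proj₂ (⊩-sub ε M w A) (proj₂ (agree (ε~lift M w) A bA)
      (proj₁ (⊩-sub μ N v A) (⊨μA (val N) (mono N) v)))
      where
      M = model V V↑
      N = proj₁ (lift (M , w))
      v = proj₂ (lift (M , w))

    -- A point `p` and the lift of `h p` have the same image under `h`, hence under `f`.
    ε-factors : ∀ x → x < n → sub colourFm (ε x) ≃ μ x
    ε-factors x x<n p@(M , w) =
      (λ ⊩ε → proj₂ (⊩-sub μ M w (var x)) (proj₁ (agree f-lift~ (var x) x<n)
                (proj₁ (⊩factorFm x x<n (h p)) (proj₁ (ε≃ x x<n (h p)) (proj₁ (⊩-sub colourFm M w (ε x)) ⊩ε))))) ,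
      (λ ⊩μ → proj₂ (⊩-sub colourFm M w (ε x)) (proj₂ (ε≃ x x<n (h p)) (proj₂ (⊩factorFm x x<n (h p))
                (proj₂ (agree f-lift~ (var x) x<n) (proj₁ (⊩-sub μ M w (var x)) ⊩μ)))))
      where
      f-lift~ : f (lift (h p)) ~[ n ] f p
      f-lift~ = h~⇒f~ (lift-lifts (h p) (in-image {p} ~-refl))

-- Substitutions with values in a finite list.

assign : ℕ → Fm → Subst → Subst
assign i B τ x with x ≟ i
... | yes _ = B
... | no _  = τ x

assignments : List Fm → Subst → ℕ → List Subst
assignments Bs τ zero    = τ ∷ []
assignments Bs τ (suc i) = cartesianProductWith (assign i) Bs (assignments Bs τ i)

assignments-complete : ∀ Bs τ (R : ℕ → Fm → Set) i → (∀ x → x < i → ∃ λ B → B ∈ Bs × R x B) →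
                       ∃ λ σ → σ ∈ assignments Bs τ i × (∀ x → x < i → R x (σ x)) × (∀ x → i ≤ⁿ x → σ x ≡ τ x)
assignments-complete Bs τ R zero    choice = τ , here refl , (λ _ ()) , λ _ _ → refl
assignments-complete Bs τ R (suc i) choice
  with assignments-complete Bs τ R i (λ x x<i → choice x (m<n⇒m<1+n x<i)) | choice i (n<1+n i)
... | σ , σ∈ , σR , σ≡ | B , B∈ , RB =
  assign i B σ , ∈-cartesianProductWith⁺ (assign i) B∈ σ∈ , below , above
  where
  below : ∀ x → x < suc i → R x (assign i B σ x)
  below x x<1+i with x ≟ i
  ... | yes refl = RB
  ... | no x≢i   = σR x ([ id , (λ x≡i → contradiction x≡i x≢i) ]′ (m<1+n⇒m<n∨m≡n x<1+i))
  above : ∀ x → i < x → assign i B σ x ≡ τ x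
  above x i<x with x ≟ i
  ... | yes refl = contradiction i<x (<-irrefl refl)
  ... | no _     = σ≡ x (<⇒≤ i<x)

maxBound : Subst → ℕ → ℕ
maxBound σ zero    = 0
maxBound σ (suc n) = maxBound σ n ⊔ bound (σ n)

maxBound-below : ∀ σ n x → x < n → Below (maxBound σ n) (σ x)
maxBound-below σ (suc n) x x<1+n with m<1+n⇒m<n∨m≡n x<1+n
... | inj₁ x<n  = Below-mono (m≤m⊔n _ _) (σ x) (maxBound-below σ n x x<n)
... | inj₂ refl = Below-mono (m≤n⊔m (maxBound σ x) _) (σ x) (below-bound (σ x))

-- A formula against projective approximation.

¬̇_ : Fm → Fm
¬̇ A = A ⇒ ⊥̇

below-occ : ∀ k A → (∀ x → Occ x A → x < k) → Below k A
below-occ k (var x) occ = occ x here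
below-occ k ⊥̇       occ = tt
below-occ k (A ∧ B) occ = below-occ k A (λ x → occ x ∘ ∧l) , below-occ k B (λ x → occ x ∘ ∧r)
below-occ k (A ∨ B) occ = below-occ k A (λ x → occ x ∘ ∨l) , below-occ k B (λ x → occ x ∘ ∨r)
below-occ k (A ⇒ B) occ = below-occ k A (λ x → occ x ∘ ⇒l) , below-occ k B (λ x → occ x ∘ ⇒r)

-- depth≤2 fails only at points of depth 3, so the unifier makes x dense but not true only at such points.
approxFm depth≤2 : Fm
approxFm = (¬̇ ¬̇ var 0) ∨ ((¬̇ ¬̇ var 0) ⇒ var 0)
depth≤2  = var 1 ∨ (var 1 ⇒ (var 2 ∨ ¬̇ var 2))

approxUnifier : Subst
approxUnifier _ = (¬̇ ¬̇ var 0) ∧ depth≤2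

occ-approxFm : ∀ x → Occ x approxFm → x < 1
occ-approxFm .0 (∨l (⇒l (⇒l here)))      = s≤s z≤n
occ-approxFm .0 (∨r (⇒l (⇒l (⇒l here)))) = s≤s z≤n
occ-approxFm .0 (∨r (⇒r here))           = s≤s z≤n

-- Finite complete sets, and a unifier of `approxFm`.

module _ (AF : AmalgamationFrame) where
  open AmalgamationFrame AF
  open Kripke finite
  open LocalFiniteness finite
  open ShapeLemmas AF

  ≃⇒⇔ : ∀ A B → A ≃ B → LogicOf frame (A ⇔ B)
  ≃⇒⇔ A B A≃B V V↑ w = (λ v _ → proj₁ (A≃B (model V V↑ , v))) , (λ v _ → proj₂ (A≃B (model V V↑ , v)))

  -- The arity `m` depends on `A` alone, so one finite list of substitutions with values in
  -- `formulas m` serves every `μ`; validity is decidable, so the unifiers in it can be selected.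
  complete-sets : ∀ A → ∃ λ Σs → Complete (LogicOf frame) A Σs
  complete-sets A = Σs , All.tabulate (λ σ∈ → proj₂ (∈-filter⁻ unifies? {xs = candidates} σ∈)) , complete
    where
    n m : ℕ
    n = bound A
    m = arity n
    candidates : List Subst
    candidates = assignments (formulas m) (λ x → var (m + x)) n
    unifies? = λ σ → logic? (sub σ A)
    Σs : List Subst
    Σs = filter unifies? candidates
    complete : ∀ μ → Unifier (LogicOf frame) A μ → Any (λ ε → ∃ λ α → _≈ˢ_ (LogicOf frame) (α ∘ˢ ε) μ) Σs
    complete μ ⊨μA = lose (∈-filter⁺ unifies? ε∈ (ε-unifies ε ε≃ A (below-bound A) ⊨μA)) (colourFm , factors)
      where
      open Factorisation AF n (maxBound μ n) μ (maxBound-below μ n)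
        using (colourFm; colourFm-rest; factorFm; factorFm-below; ε-unifies; ε-factors)
      Represents : ℕ → Fm → Set
      -- `factorFm` takes the proof of `x < n` as an argument, so `B` has to represent it for all
      -- such proofs.
      Represents x B = (x<n : x < n) → B ≃ factorFm x x<n
      representative : ∀ x → x < n → ∃ λ B → B ∈ formulas m × Represents x B
      representative x x<n with formulas-complete m (factorFm x x<n) (factorFm-below x x<n)
      ... | B , B∈ , ≃B = B , B∈ , λ x<n' → subst (λ lt → B ≃ factorFm x lt) (<-irrelevant x<n x<n')
                                              (λ p → proj₂ (≃B p) , proj₁ (≃B p))
      assigned = assignments-complete (formulas m) (λ x → var (m + x)) Represents n representative
      ε : Subst
      ε = proj₁ assigned
      ε∈ : ε ∈ candidates
      ε∈ = proj₁ (proj₂ assigned)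
      ε≃ : ∀ x (x<n : x < n) → ε x ≃ factorFm x x<n
      ε≃ x x<n = proj₁ (proj₂ (proj₂ assigned)) x x<n x<n
      ε-rest : ∀ x → n ≤ⁿ x → ε x ≡ var (m + x)
      ε-rest = proj₂ (proj₂ (proj₂ assigned))
      factors : ∀ x → LogicOf frame (sub colourFm (ε x) ⇔ μ x)
      factors x with x <? n
      ... | yes x<n = ≃⇒⇔ (sub colourFm (ε x)) (μ x) (ε-factors ε ε≃ x x<n)
      ... | no x≮n rewrite ε-rest x (≮⇒≥ x≮n) | colourFm-rest x = ≃⇒⇔ (μ x) (μ x) (λ _ → id , id)

  -- If the unifier's value is not dense at `w`, it is dense at most at proper successors. There
  -- `depth≤2` holds, and the density of the value yields its first conjunct.
  approxUnifier-unifies : LogicOf frame (sub approxUnifier approxFm)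
  approxUnifier-unifies V V↑ w = decide ((M , w) ⊩? (¬̇ ¬̇ approxUnifier 0))
    where
    M : Model
    M = model V V↑
    maximal-em : ∀ {v} → Maximal v → (M , v) ⊩ (var 2 ∨ ¬̇ var 2)
    maximal-em {v} max with (M , v) ⊩? var 2
    ... | yes ⊩z = inj₁ ⊩z
    ... | no ⊮z  = inj₂ λ u v≤u ⊩z → ⊮z (subst (λ y → (M , y) ⊩ var 2) (max u v≤u) ⊩z)
    maximal-depth : ∀ {v} → Maximal v → (M , v) ⊩ depth≤2
    maximal-depth max = inj₂ λ u v≤u _ → subst (λ y → (M , y) ⊩ (var 2 ∨ ¬̇ var 2)) (sym (max u v≤u)) (maximal-em max)
    fork-depth : ∀ {v v₁ v₂} → Fork v v₁ v₂ → (M , v) ⊩ depth≤2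
    fork-depth {v} F with (M , v) ⊩? var 1
    ... | yes ⊩y = inj₁ ⊩y
    -- Since `var 1` fails at `v`, it can hold only at the prongs, where excluded middle is true by
    -- maximality.
    ... | no ⊮y  = inj₂ λ u v≤u ⊩y → case (Fork.cover F u v≤u) ⊩y
      where
      case : ∀ {u} → u ≡ v ⊎ u ≡ _ ⊎ u ≡ _ → (M , u) ⊩ var 1 → (M , u) ⊩ (var 2 ∨ ¬̇ var 2)
      case (inj₁ refl)        ⊩y = contradiction ⊩y ⊮y
      case (inj₂ (inj₁ refl)) _  = maximal-em (Fork.max₁ F)
      case (inj₂ (inj₂ refl)) _  = maximal-em (Fork.max₂ F)
    proper-depth : ∀ v → w ≤ v → v ≡ w ⊎ (M , v) ⊩ depth≤2
    proper-depth v w≤v with kind w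
    ... | maximal max = inj₁ (max v w≤v)
    ... | fork _ _ F  = inj₂ (persist M w≤v depth≤2 (fork-depth F))
    ... | root₁ _ s _ _ R = Sum.map₂
            [ (λ { refl → maximal-depth (Root₁.maxᵥ R) })
            , (λ s≤v → persist M s≤v depth≤2 (fork-depth (Root₁.fork R))) ]′ (Root₁.cover R v w≤v)
    ... | root₂ _ _ _ _ _ R = Sum.map₂
            [ (λ y≤v → persist M y≤v depth≤2 (fork-depth (Root₂.forkᵥ R)))
            , (λ y≤v → persist M y≤v depth≤2 (fork-depth (Root₂.forkₛ R))) ]′ (Root₂.cover R v w≤v)
    decide : Dec ((M , w) ⊩ (¬̇ ¬̇ approxUnifier 0)) → (M , w) ⊩ sub approxUnifier approxFm
    decide (yes ⊩¬¬μ) = inj₁ ⊩¬¬μ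
    decide (no ⊮¬¬μ)  = inj₂ λ v w≤v ⊩¬¬μ →
      [ (λ { refl → contradiction ⊩¬¬μ ⊮¬¬μ })
      , (λ ⊩depth → (λ u v≤u ⊩¬p → ⊩¬¬μ u v≤u λ y u≤y (⊩¬¬p , _) → ⊩¬¬p y ≤-refl (persist M u≤y (¬̇ var 0) ⊩¬p))
                    , ⊩depth) ]′ (proper-depth v w≤v)

-- The frames `𝔊₂` and `ℭ₅`, and the shapes of their worlds.

T-fst : ∀ {x y} → T (x && y) → T x
T-fst = proj₁ ∘ Equivalence.to T-∧

T-snd : ∀ {x y} → T (x && y) → T y
T-snd = proj₂ ∘ Equivalence.to T-∧

G2-finite : FiniteFrame
G2-finite = record
  { frame = 𝔊₂ ; _≤?_ = λ u v → T? (leqG2 u v)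
  ; ≤-refl = λ { {r} → tt ; {a} → tt ; {b} → tt ; {c} → tt ; {d} → tt }
  ; ≤-trans = λ { {r} _ _ → tt ; {a} {a} _ p → p ; {b} {b} _ p → p
                ; {b} {c} {c} _ p → tt ; {b} {d} {d} _ p → tt ; {c} {c} _ p → p ; {d} {d} _ p → p }
  ; worlds = r ∷ a ∷ b ∷ c ∷ d ∷ []
  ; ∈-worlds = λ { r → here refl ; a → there (here refl) ; b → there (there (here refl))
                 ; c → there (there (there (here refl))) ; d → there (there (there (there (here refl)))) } }

C5-finite : FiniteFrame
C5-finite = record
  { frame = ℭ₅ ; _≤?_ = λ u v → T? (leqC5 u v)
  ; ≤-refl = λ { {r} → tt ; {a} → tt ; {b} → tt ; {c} → tt ; {t} → tt ; {d} → tt }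
  ; ≤-trans = λ { {r} _ _ → tt ; {a} {a} _ p → p ; {a} {c} {c} _ _ → tt ; {a} {t} {t} _ _ → tt
                ; {b} {b} _ p → p ; {b} {t} {t} _ _ → tt ; {b} {d} {d} _ _ → tt
                ; {c} {c} _ p → p ; {t} {t} _ p → p ; {d} {d} _ p → p }
  ; worlds = r ∷ a ∷ b ∷ c ∷ t ∷ d ∷ []
  ; ∈-worlds = λ { r → here refl ; a → there (here refl) ; b → there (there (here refl))
                 ; c → there (there (there (here refl))) ; t → there (there (there (there (here refl))))
                 ; d → there (there (there (there (there (here refl))))) } }

module G2-shapes where
  open Kripke G2-finite
  open Shapes G2-finite

  painting : (u x u₁ u₂ : Colour) → Model
  painting u x u₁ u₂ = model V V↑
    where
    V : Valuation 𝔊₂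
    V i r = false
    V i a = u i
    V i b = x i && (u₁ i && u₂ i)
    V i c = u₁ i
    V i d = u₂ i
    V↑ : Monotone 𝔊₂ V
    V↑ i {a} {a} _ p = p
    V↑ i {b} {b} _ p = p
    V↑ i {b} {c} _ p = T-fst (T-snd {x i} p)
    V↑ i {b} {d} _ p = T-snd {u₁ i} (T-snd {x i} p)
    V↑ i {c} {c} _ p = p
    V↑ i {d} {d} _ p = p

  a-max : Maximal a
  a-max a _ = refl
  c-max : Maximal c
  c-max c _ = refl
  d-max : Maximal d
  d-max d _ = refl

  b-fork : Fork b c d
  b-fork = record
    { max₁ = c-max ; max₂ = d-max ; w≤v₁ = tt ; w≤v₂ = tt
    ; cover = λ { b _ → inj₁ refl ; c _ → inj₂ (inj₁ refl) ; d _ → inj₂ (inj₂ refl) }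
    ; paint = λ x u₁ u₂ → painting x x u₁ u₂ , (λ _ → refl) , (λ _ → refl) , (λ _ → refl) }

  r-root : Root₁ r a b c d
  r-root = record
    { maxᵥ = a-max ; fork = b-fork ; w≤v = tt ; w≤s = tt
    ; cover = λ { r _ → inj₁ refl ; a _ → inj₂ (inj₁ refl) ; b _ → inj₂ (inj₂ tt)
                ; c _ → inj₂ (inj₂ tt) ; d _ → inj₂ (inj₂ tt) }
    ; paint = λ u x u₁ u₂ → painting u x u₁ u₂ , (λ _ → refl) , (λ _ → refl) , (λ _ → refl) , (λ _ → refl) }

  kinds : ∀ w → Kind w
  kinds r = root₁ a b c d r-root
  kinds a = maximal a-max
  kinds b = fork c d b-fork
  kinds c = maximal c-max
  kinds d = maximal d-max

module C5-shapes where
  open Kripke C5-finite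
  open Shapes C5-finite

  painting : (x y u u₁ u₂ : Colour) → Model
  painting x y u u₁ u₂ = model V V↑
    where
    V : Valuation ℭ₅
    V i r = false
    V i a = x i && (u i && u₁ i)
    V i b = y i && (u i && u₂ i)
    V i c = u₁ i
    V i t = u i
    V i d = u₂ i
    V↑ : Monotone ℭ₅ V
    V↑ i {a} {a} _ p = p
    V↑ i {a} {c} _ p = T-snd {u i} (T-snd {x i} p)
    V↑ i {a} {t} _ p = T-fst (T-snd {x i} p)
    V↑ i {b} {b} _ p = p
    V↑ i {b} {t} _ p = T-fst (T-snd {y i} p)
    V↑ i {b} {d} _ p = T-snd {u i} (T-snd {y i} p)
    V↑ i {c} {c} _ p = p
    V↑ i {t} {t} _ p = p
    V↑ i {d} {d} _ p = p

  c-max : Maximal c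
  c-max c _ = refl
  t-max : Maximal t
  t-max t _ = refl
  d-max : Maximal d
  d-max d _ = refl

  -- `t` comes first here and in `b-fork`, because `Root₂` expects the shared prong in that place.
  a-fork : Fork a t c
  a-fork = record
    { max₁ = t-max ; max₂ = c-max ; w≤v₁ = tt ; w≤v₂ = tt
    ; cover = λ { a _ → inj₁ refl ; t _ → inj₂ (inj₁ refl) ; c _ → inj₂ (inj₂ refl) }
    ; paint = λ x u₁ u₂ → painting x x u₁ u₂ u₂ , (λ _ → refl) , (λ _ → refl) , (λ _ → refl) }

  b-fork : Fork b t d
  b-fork = record
    { max₁ = t-max ; max₂ = d-max ; w≤v₁ = tt ; w≤v₂ = tt
    ; cover = λ { b _ → inj₁ refl ; t _ → inj₂ (inj₁ refl) ; d _ → inj₂ (inj₂ refl) }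
    ; paint = λ x u₁ u₂ → painting x x u₁ u₂ u₂ , (λ _ → refl) , (λ _ → refl) , (λ _ → refl) }

  r-root : Root₂ r a b t c d
  r-root = record
    { forkᵥ = a-fork ; forkₛ = b-fork ; w≤v = tt ; w≤s = tt
    ; cover = λ { r _ → inj₁ refl ; a _ → inj₂ (inj₁ tt) ; b _ → inj₂ (inj₂ tt)
                ; c _ → inj₂ (inj₁ tt) ; t _ → inj₂ (inj₁ tt) ; d _ → inj₂ (inj₂ tt) }
    ; paint = λ x y u u₁ u₂ → painting x y u u₁ u₂ , (λ _ → refl) , (λ _ → refl)
                , (λ _ → refl) , (λ _ → refl) , (λ _ → refl) }

  kinds : ∀ w → Kind w
  kinds r = root₂ a b t c d r-root
  kinds a = fork t c a-fork
  kinds b = fork t d b-fork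
  kinds c = maximal c-max
  kinds t = maximal t-max
  kinds d = maximal d-max

-- Generated subframes and the disjoint union.

record Embedding (F F' : FiniteFrame) : Set where
  module F = FiniteFrame F
  module F' = FiniteFrame F'
  field
    ι      : F.W → F'.W
    ι-mono : ∀ {w v} → w F.≤ v → ι w F'.≤ ι v
    ι-up   : ∀ {w v'} → ι w F'.≤ v' → ∃ λ v → v' ≡ ι v × w F.≤ v
    extend : (M : Kripke.Model F) → ∃ λ (M' : Kripke.Model F') → ∀ x w → Kripke.val M' x (ι w) ≡ Kripke.val M x w

module EmbeddingLemmas {F F' : FiniteFrame} (E : Embedding F F') where
  open Embedding E
  module S = Shapes F
  module S' = Shapes F'
  open Kripke using (val)

  forces-ι : ∀ {V V'} → (∀ x w → V' x (ι w) ≡ V x w) → ∀ A w → Forces F'.frame V' (ι w) A iff Forces F.frame V w A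
  forces-ι V≡ (var x) w rewrite V≡ x w = id , id
  forces-ι V≡ ⊥̇       w = id , id
  forces-ι V≡ (A ∧ B) w = (λ (⊩A , ⊩B) → proj₁ (forces-ι V≡ A w) ⊩A , proj₁ (forces-ι V≡ B w) ⊩B)
                        , (λ (⊩A , ⊩B) → proj₂ (forces-ι V≡ A w) ⊩A , proj₂ (forces-ι V≡ B w) ⊩B)
  forces-ι V≡ (A ∨ B) w = Sum.map (proj₁ (forces-ι V≡ A w)) (proj₁ (forces-ι V≡ B w))
                        , Sum.map (proj₂ (forces-ι V≡ A w)) (proj₂ (forces-ι V≡ B w))
  forces-ι {V} {V'} V≡ (A ⇒ B) w =
    (λ ⊩A⇒B v w≤v ⊩A → proj₁ (forces-ι V≡ B v) (⊩A⇒B (ι v) (ι-mono w≤v) (proj₂ (forces-ι V≡ A v) ⊩A))) ,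
    (λ ⊩A⇒B v' w≤v' → above ⊩A⇒B v' (ι-up w≤v'))
    where
    above : Forces F.frame V w (A ⇒ B) → ∀ v' → (∃ λ v → v' ≡ ι v × w F.≤ v) →
            Forces F'.frame V' v' A → Forces F'.frame V' v' B
    above ⊩A⇒B _ (v , refl , w≤v) ⊩A = proj₂ (forces-ι V≡ B v) (⊩A⇒B v w≤v (proj₁ (forces-ι V≡ A v) ⊩A))

  logic-ι : ∀ A → LogicOf F'.frame A → LogicOf F.frame A
  logic-ι A ⊨A V V↑ w with extend (Kripke.model V V↑)
  ... | Kripke.model V' V'↑ , V'≡ = proj₁ (forces-ι V'≡ A w) (⊨A V' V'↑ (ι w))

  restrict : ∀ A → LogicOf F.frame A → ∀ V' → Monotone F'.frame V' → ∀ w → Forces F'.frame V' (ι w) A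
  restrict A ⊨A V' V'↑ w = proj₂ (forces-ι (λ _ _ → refl) A w)
    (⊨A (λ x v → V' x (ι v)) (λ x u≤v → V'↑ x (ι-mono u≤v)) w)

  ι-maximal : ∀ {w} → S.Maximal w → S'.Maximal (ι w)
  ι-maximal max v' ιw≤v' with ι-up ιw≤v'
  ... | v , refl , w≤v = cong ι (max v w≤v)

  ι-≐ : ∀ {M : Kripke.Model F} {M' : Kripke.Model F'} {w u} → (∀ x w → val M' x (ι w) ≡ val M x w) → M S.∙ w ≐ u → M' S'.∙ ι w ≐ u
  ι-≐ {w = w} M'≡ M≐ x = trans (M'≡ x w) (M≐ x)

  ι-fork : ∀ {w v₁ v₂} → S.Fork w v₁ v₂ → S'.Fork (ι w) (ι v₁) (ι v₂)
  ι-fork φ = record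
    { max₁ = ι-maximal max₁ ; max₂ = ι-maximal max₂ ; w≤v₁ = ι-mono w≤v₁ ; w≤v₂ = ι-mono w≤v₂
    ; cover = λ v' ≤v' → let (v , v'≡ , w≤v) = ι-up ≤v' in
        Sum.map (λ v≡ → trans v'≡ (cong ι v≡)) (Sum.map (λ v≡ → trans v'≡ (cong ι v≡)) (λ v≡ → trans v'≡ (cong ι v≡)))
                (cover v w≤v)
    ; paint = λ u u₁ u₂ → let (M , p , p₁ , p₂) = paint u u₁ u₂ ; (M' , M'≡) = extend M in
        M' , ι-≐ {M} {M'} M'≡ p , ι-≐ {M} {M'} M'≡ p₁ , ι-≐ {M} {M'} M'≡ p₂ }
    where open S.Fork φ

  -- A shape speaks only of points above `w`; the image of an embedding is closed upwards and every
  -- valuation extends from it.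
  ι-kind : ∀ {w} → S.Kind w → S'.Kind (ι w)
  ι-kind (S.maximal max)   = S'.maximal (ι-maximal max)
  ι-kind (S.fork _ _ φ)    = S'.fork _ _ (ι-fork φ)
  ι-kind (S.root₁ v s s₁ s₂ R) = S'.root₁ (ι v) (ι s) (ι s₁) (ι s₂) record
    { maxᵥ = ι-maximal maxᵥ ; fork = ι-fork φ ; w≤v = ι-mono w≤v ; w≤s = ι-mono w≤s
    ; cover = λ y' ≤y' → let (y , y'≡ , w≤y) = ι-up ≤y' in
        Sum.map (λ y≡ → trans y'≡ (cong ι y≡)) (Sum.map (λ y≡ → trans y'≡ (cong ι y≡))
                (λ s≤y → subst (ι s F'.≤_) (sym y'≡) (ι-mono s≤y))) (cover y w≤y)
    ; paint = λ u x u₁ u₂ → let (M , p , p₁ , p₂ , p₃) = paint u x u₁ u₂ ; (M' , M'≡) = extend M in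
        M' , ι-≐ {M} {M'} M'≡ p , ι-≐ {M} {M'} M'≡ p₁ , ι-≐ {M} {M'} M'≡ p₂ , ι-≐ {M} {M'} M'≡ p₃ }
    where open S.Root₁ R renaming (fork to φ)
  ι-kind (S.root₂ v s m v₁ s₁ R) = S'.root₂ (ι v) (ι s) (ι m) (ι v₁) (ι s₁) record
    { forkᵥ = ι-fork forkᵥ ; forkₛ = ι-fork forkₛ ; w≤v = ι-mono w≤v ; w≤s = ι-mono w≤s
    ; cover = λ y' ≤y' → let (y , y'≡ , w≤y) = ι-up ≤y' in
        Sum.map (λ y≡ → trans y'≡ (cong ι y≡)) (Sum.map (λ v≤y → subst (ι v F'.≤_) (sym y'≡) (ι-mono v≤y))
                (λ s≤y → subst (ι s F'.≤_) (sym y'≡) (ι-mono s≤y))) (cover y w≤y)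
    ; paint = λ x y u u₁ u₂ → let (M , p , p₁ , p₂ , p₃ , p₄) = paint x y u u₁ u₂ ; (M' , M'≡) = extend M in
        M' , ι-≐ {M} {M'} M'≡ p , ι-≐ {M} {M'} M'≡ p₁ , ι-≐ {M} {M'} M'≡ p₂ , ι-≐ {M} {M'} M'≡ p₃
           , ι-≐ {M} {M'} M'≡ p₄ }
    where open S.Root₂ R

-- The disjoint union presents the intersection of the two logics as the logic of a single frame, to
-- which the same argument applies.
_≤⊎_ : G2 ⊎ C5 → G2 ⊎ C5 → Set
inj₁ u ≤⊎ inj₁ v = T (leqG2 u v)
inj₂ u ≤⊎ inj₂ v = T (leqC5 u v)
_      ≤⊎ _      = ⊥

G2⊎C5-finite : FiniteFrame
G2⊎C5-finite = record
  { frame = record { W = G2 ⊎ C5 ; _≤_ = _≤⊎_ }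
  ; _≤?_ = λ { (inj₁ u) (inj₁ v) → T? (leqG2 u v) ; (inj₂ u) (inj₂ v) → T? (leqC5 u v)
             ; (inj₁ _) (inj₂ _) → no id ; (inj₂ _) (inj₁ _) → no id }
  ; ≤-refl = λ { {inj₁ u} → G.≤-refl {u} ; {inj₂ u} → C.≤-refl {u} }
  ; ≤-trans = λ { {inj₁ u} {inj₁ v} {inj₁ w} → G.≤-trans {u} {v} {w}
                ; {inj₂ u} {inj₂ v} {inj₂ w} → C.≤-trans {u} {v} {w} }
  ; worlds = map inj₁ G.worlds ++ map inj₂ C.worlds
  ; ∈-worlds = λ { (inj₁ w) → ∈-++⁺ˡ (∈-map⁺ inj₁ (G.∈-worlds w))
                 ; (inj₂ w) → ∈-++⁺ʳ (map inj₁ G.worlds) (∈-map⁺ inj₂ (C.∈-worlds w)) } }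
  where
  module G = FiniteFrame G2-finite
  module C = FiniteFrame C5-finite

G2↪G2⊎C5 : Embedding G2-finite G2⊎C5-finite
G2↪G2⊎C5 = record
  { ι = inj₁ ; ι-mono = id ; ι-up = λ { {v' = inj₁ v} w≤v → v , refl , w≤v }
  ; extend = λ M → extension M , λ _ _ → refl }
  where
  extension : Kripke.Model G2-finite → Kripke.Model G2⊎C5-finite
  extension (Kripke.model V V↑) = Kripke.model (λ x → [ V x , (λ _ → false) ]′)
    λ { x {inj₁ _} {inj₁ _} → V↑ x ; x {inj₂ _} {inj₂ _} _ () }

C5↪G2⊎C5 : Embedding C5-finite G2⊎C5-finite
C5↪G2⊎C5 = record
  { ι = inj₂ ; ι-mono = id ; ι-up = λ { {v' = inj₂ v} w≤v → v , refl , w≤v }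
  ; extend = λ M → extension M , λ _ _ → refl }
  where
  extension : Kripke.Model C5-finite → Kripke.Model G2⊎C5-finite
  extension (Kripke.model V V↑) = Kripke.model (λ x → [ (λ _ → false) , V x ]′)
    λ { x {inj₂ _} {inj₂ _} → V↑ x ; x {inj₁ _} {inj₁ _} _ () }

G2-amalgamation : AmalgamationFrame
G2-amalgamation = record { finite = G2-finite ; kind = G2-shapes.kinds ; ψ-fork = G2-shapes.b-fork }

G2⊎C5-amalgamation : AmalgamationFrame
G2⊎C5-amalgamation = record
  { finite = G2⊎C5-finite
  ; kind   = λ { (inj₁ w) → EmbeddingLemmas.ι-kind G2↪G2⊎C5 (G2-shapes.kinds w)
               ; (inj₂ w) → EmbeddingLemmas.ι-kind C5↪G2⊎C5 (C5-shapes.kinds w) }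
  -- By `repaint-fork`, the forks of `ℭ₅` are represented at this fork of `𝔊₂` as well.
  ; ψ-fork = EmbeddingLemmas.ι-fork G2↪G2⊎C5 G2-shapes.b-fork }

intersection-logic : ∀ A → (LogicOf 𝔊₂ ∩L LogicOf ℭ₅) A iff LogicOf (FiniteFrame.frame G2⊎C5-finite) A
intersection-logic A =
  (λ (⊨G , ⊨C) V V↑ → λ { (inj₁ w) → EmbeddingLemmas.restrict G2↪G2⊎C5 A ⊨G V V↑ w
                        ; (inj₂ w) → EmbeddingLemmas.restrict C5↪G2⊎C5 A ⊨C V V↑ w }) ,
  (λ ⊨A → EmbeddingLemmas.logic-ι G2↪G2⊎C5 A ⊨A , EmbeddingLemmas.logic-ι C5↪G2⊎C5 A ⊨A)

-- Finitarity, and the negative results by models over `𝔊₂`.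

module _ (AF : AmalgamationFrame) (L : Logic)
         (L⇔ : ∀ A → L A iff LogicOf (AmalgamationFrame.frame AF) A)
         (L⊆G2 : ∀ A → L A → LogicOf 𝔊₂ A) where

  open G2-shapes
  open Kripke G2-finite
  open Shapes G2-finite
  open LocalFiniteness G2-finite
  open ShapeLemmas G2-amalgamation using (max~; iff-≡; colour)

  private
    M₀ : Model
    M₀ = model (λ _ _ → false) (λ _ _ ())

  ⊤̇ : Fm
  ⊤̇ = ⊥̇ ⇒ ⊥̇

  -- Any two maximal points have a common lower bound in G2, so a unifier of x ∨ ¬x is constant.
  not-unitary : ¬ Unitary L
  not-unitary unitary
    with unitary (var 0 ∨ ¬̇ var 0) ((λ _ → ⊤̇) , proj₂ (L⇔ _) λ _ _ _ → inj₁ λ _ _ ())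
  ... | ε , (ε-unifies ∷ []) , complete
    with complete (λ _ → ⊤̇) (proj₂ (L⇔ _) λ _ _ _ → inj₁ λ _ _ ())
       | complete (λ _ → ⊥̇) (proj₂ (L⇔ _) λ _ _ _ → inj₂ λ _ _ ())
  ... | here (α , α≈) | here (β , β≈) =
    [ (λ ⊩ε → ⊮ε-c (persist K {r} {c} tt (ε 0) ⊩ε)) , (λ ⊩¬ε → ⊩¬ε a tt ⊩ε-a) ]′
      (L⊆G2 _ ε-unifies (val K) (mono K) r)
    where
    K : Model
    -- `a` gets colours under which `ε 0` is true, as `α` recovers `⊤̇`, and `c` colours under which
    -- it is false, as `β` recovers `⊥̇`; so the root decides neither way.
    K = painting (colour (substModel α M₀) c) (λ _ → true) (colour (substModel β M₀) c) (λ _ → false)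
    ⊩ε-a : (K , a) ⊩ ε 0
    ⊩ε-a = proj₂ (agree (max~ {bound (ε 0)} {K} {a} {substModel α M₀} {c} a-max c-max (λ x _ → id , id))
                        (ε 0) (below-bound (ε 0)))
      (proj₁ (⊩-sub α M₀ c (ε 0)) (proj₂ (L⊆G2 _ (α≈ 0) (val M₀) (mono M₀) c) c tt λ _ _ ()))
    ⊮ε-c : ¬ ((K , c) ⊩ ε 0)
    ⊮ε-c ⊩ε = proj₁ (L⊆G2 _ (β≈ 0) (val M₀) (mono M₀) c) c tt
      (proj₂ (⊩-sub β M₀ c (ε 0)) (proj₁ (agree (max~ {bound (ε 0)} {K} {c} {substModel β M₀} {c} c-max c-max (λ x _ → id , id))
                        (ε 0) (below-bound (ε 0))) ⊩ε))

  finitary : Finitary L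
  finitary = not-unitary , λ A _ →
    let (Σs , unifiers , complete) = complete-sets AF A in
    Σs , All.map (proj₂ (L⇔ _)) unifiers ,
    λ μ ⊨μA → Any.map (λ (α , α≈) → α , λ x → proj₂ (L⇔ _) (α≈ x)) (complete μ (proj₁ (L⇔ _) ⊨μA))

  -- The chain r < b < c refutes depth≤2 at r only.
  deep : Model
  deep = model V V↑
    where
    V : Valuation 𝔊₂
    V 1 r = false
    V 2 r = false
    V 2 b = false
    V _ _ = true
    V↑ : Monotone 𝔊₂ V
    V↑ 0 _ _ = tt
    V↑ 1 {a} {a} _ _ = tt
    V↑ 1 {b} {b} _ _ = tt
    V↑ 1 {b} {c} _ _ = tt
    V↑ 1 {b} {d} _ _ = tt
    V↑ 1 {c} {c} _ _ = tt
    V↑ 1 {d} {d} _ _ = tt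
    V↑ 2 {a} {a} _ _ = tt
    V↑ 2 {c} {c} _ _ = tt
    V↑ 2 {d} {d} _ _ = tt
    V↑ (suc (suc (suc _))) _ _ = tt

  -- The configuration to be ruled out: `a` forces the negation of `x`, `b` has `x` dense but false,
  -- and `r` lies below both.
  half : Model
  half = painting (λ _ → false) (λ _ → false) (λ _ → true) (λ _ → true)

  deep⊩ : ∀ w → ¬ w ≡ r → (deep , w) ⊩ approxUnifier 0
  deep⊩ r w≢r = contradiction refl w≢r
  deep⊩ a _ = (λ w w≤ ¬p → ¬p w (FiniteFrame.≤-refl G2-finite {w}) tt) , inj₁ tt
  deep⊩ b _ = (λ w w≤ ¬p → ¬p w (FiniteFrame.≤-refl G2-finite {w}) tt) , inj₁ tt
  deep⊩ c _ = (λ w w≤ ¬p → ¬p w (FiniteFrame.≤-refl G2-finite {w}) tt) , inj₁ tt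
  deep⊩ d _ = (λ w w≤ ¬p → ¬p w (FiniteFrame.≤-refl G2-finite {w}) tt) , inj₁ tt

  deep⊮ : ¬ ((deep , r) ⊩ approxUnifier 0)
  deep⊮ (_ , inj₂ y⇒em) with y⇒em b tt tt
  ... | inj₂ ¬z = ¬z c tt tt

  deep-atom : ∀ w v → ¬ w ≡ r → T (val half 0 v) → ∀ x → x < 1 →
              T (val (substModel approxUnifier deep) x w) iff T (val half x v)
  deep-atom w v w≢r ⊩v zero _ = (λ _ → ⊩v) , λ _ → proj₁ (⊩-sub approxUnifier deep w (var 0)) (deep⊩ w w≢r)
  deep-atom w v w≢r ⊩v (suc _) (s≤s ())

  -- Under the unifier `x` fails only at `r`, so all points strictly above `r` look like one maximal
  -- point, and `r` looks like the bottom of a two-element chain. So does `b` in `half`, whose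
  -- prongs have equal colours.
  deep~half : (substModel approxUnifier deep , r) ~[ 1 ] (half , b)
  deep~half = ~-step
    (λ { zero _ → (λ ⊩x → contradiction (proj₂ (⊩-sub approxUnifier deep r (var 0)) ⊩x) deep⊮) , λ ()
       ; (suc _) (s≤s ()) })
    (λ { r _ → inj₁ refl ; a _ → inj₂ (c , tt , a~c) ; b _ → inj₂ (c , tt , b~c)
       ; c _ → inj₂ (c , tt , c~c) ; d _ → inj₂ (c , tt , d~c) })
    (λ { b _ → inj₁ refl ; c _ → inj₂ (c , tt , c~c) ; d _ → inj₂ (d , tt , d~d) })
    where
    a~c : (substModel approxUnifier deep , a) ~[ 1 ] (half , c)
    a~c = max~ a-max c-max (deep-atom a c (λ ()) tt)
    c~c : (substModel approxUnifier deep , c) ~[ 1 ] (half , c)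
    c~c = max~ c-max c-max (deep-atom c c (λ ()) tt)
    d~c : (substModel approxUnifier deep , d) ~[ 1 ] (half , c)
    d~c = max~ d-max c-max (deep-atom d c (λ ()) tt)
    d~d : (substModel approxUnifier deep , d) ~[ 1 ] (half , d)
    d~d = max~ d-max d-max (deep-atom d d (λ ()) tt)
    b~c : (substModel approxUnifier deep , b) ~[ 1 ] (half , c)
    b~c = ~-step (deep-atom b c (λ ()) tt)
      (λ { b _ → inj₁ refl ; c _ → inj₂ (c , tt , c~c) ; d _ → inj₂ (c , tt , d~c) })
      (λ { c _ → inj₁ refl })

  empty~half : (substModel approxUnifier M₀ , a) ~[ 1 ] (half , a)
  empty~half = max~ a-max a-max
    λ { zero _ → (λ ⊩x → ⊮p (proj₁ (proj₂ (⊩-sub approxUnifier M₀ a (var 0)) ⊩x))) , λ () ; (suc _) (s≤s ()) }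
    where
    ⊮p : ¬ ((M₀ , a) ⊩ (¬̇ ¬̇ var 0))
    ⊮p ⊩¬¬p = ⊩¬¬p a tt λ _ _ ()

  -- B holds at the points a and b of `half`, so ε agrees with the identity on them;
  -- but no point of a model of approxFm lies below both.
  no-projective-approximation : ¬ ProjectiveApproximation L
  no-projective-approximation approximation
    with approximation approxFm
  ... | Π , projective , covers
    with find (covers approxUnifier (proj₂ (L⇔ _) (approxUnifier-unifies AF)))
  ... | B , B∈ , ⊨μB with All.lookup projective B∈
  ... | (ε , ⊨εB , ε⇔id) , occ , B⊢A =
    -- At `r` the first disjunct is refuted by `a`, where `x` stays false, and the second by `b`,
    -- where `x` is dense but false.
    [ (λ ⊩¬¬x → ⊩¬¬x a tt λ { a _ ⊩x → proj₂ (ε-at a (inj₁ refl)) ⊩x })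
    , (λ ¬¬x⇒x → proj₂ (ε-at b (inj₂ tt)) (¬¬x⇒x b tt λ
        { b _ ⊩¬x → ⊩¬x c tt (proj₁ (ε-at c (inj₂ tt)) tt)
        ; c _ ⊩¬x → ⊩¬x c tt (proj₁ (ε-at c (inj₂ tt)) tt)
        ; d _ ⊩¬x → ⊩¬x d tt (proj₁ (ε-at d (inj₂ tt)) tt) })) ]′ ⊩A
    where
    B-below : Below 1 B
    B-below = below-occ 1 B (λ x → occ-approxFm x ∘ occ x)
    valid : ∀ M w → (M , w) ⊩ sub approxUnifier B
    valid M w = L⊆G2 _ ⊨μB (val M) (mono M) w
    b⊩B : (half , b) ⊩ B
    b⊩B = proj₁ (agree deep~half B B-below) (proj₁ (⊩-sub approxUnifier deep r B) (valid deep r))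
    a⊩B : (half , a) ⊩ B
    a⊩B = proj₁ (agree empty~half B B-below) (proj₁ (⊩-sub approxUnifier M₀ a B) (valid M₀ a))
    ⊩B : ∀ w → w ≡ a ⊎ T (leqG2 b w) → (half , w) ⊩ B
    ⊩B .a (inj₁ refl) = a⊩B
    ⊩B w  (inj₂ b≤w)  = persist half b≤w B b⊩B
    ε-at : ∀ w → w ≡ a ⊎ T (leqG2 b w) → T (val half 0 w) iff ((substModel ε half , w) ⊩ var 0)
    ε-at w above with L⊆G2 _ (ε⇔id 0) (val half) (mono half) r w tt (⊩B w above)
    ... | ε⇒x , x⇒ε = (λ ⊩x → proj₁ (⊩-sub ε half w (var 0)) (x⇒ε w (FiniteFrame.≤-refl G2-finite {w}) ⊩x))
                    , (λ ⊩ε → ε⇒x w (FiniteFrame.≤-refl G2-finite {w}) (proj₂ (⊩-sub ε half w (var 0)) ⊩ε))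
    ⊩A : (substModel ε half , r) ⊩ approxFm
    ⊩A = L⊆G2 _ B⊢A (val (substModel ε half)) (mono (substModel ε half)) r r tt
      (proj₁ (⊩-sub ε half r B) (L⊆G2 _ ⊨εB (val half) (mono half) r))

theorem4p15 : (Finitary (LogicOf 𝔊₂) × ¬ ProjectiveApproximation (LogicOf 𝔊₂))
    × (Finitary (LogicOf 𝔊₂ ∩L LogicOf ℭ₅) × ¬ ProjectiveApproximation (LogicOf 𝔊₂ ∩L LogicOf ℭ₅))
theorem4p15 =
  ( finitary G2-amalgamation (LogicOf 𝔊₂) (λ _ → id , id) (λ _ → id)
  , no-projective-approximation G2-amalgamation (LogicOf 𝔊₂) (λ _ → id , id) (λ _ → id) ) ,
  ( finitary G2⊎C5-amalgamation (LogicOf 𝔊₂ ∩L LogicOf ℭ₅) intersection-logic (λ _ → proj₁)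
  , no-projective-approximation G2⊎C5-amalgamation (LogicOf 𝔊₂ ∩L LogicOf ℭ₅) intersection-logic (λ _ → proj₁) )
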